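{- For $n\ge 2$, the expected number of indices $k\in\{2,\dots,n\}$ such that the $(k-1)$-th and $k$-th boundary steps are both west steps, in a uniformly random type-B permutation tableau of size $n$, equals \[ \frac{14n-25}{24}+\frac{1}{2n}. \]
   Context: A Ferrers diagram is a left-justified array of cells whose row lengths weakly decrease from top to bottom (rows of length $0$ are allowed). Its half-perimeter is the number of rows plus the number of columns. Its southeast boundary, traversed from the northeast corner to the southwest corner, consists of $n$ unit steps, each south or west; south steps correspond to rows and west steps to columns. If the diagram has $c$ columns, the shifted Ferrers diagram is obtained by inserting $c$ new left-justified rows above it, of lengths $c,c-1,\dots,1$ from top to bottom; the rightmost cell of each inserted row is a diagonal cell. A type-B permutation tableau of size $n$ is a filling of a shifted Ferrers diagram of half-perimeter $n$ with $0$'s and $1$'s such that: (1) every column contains at least one $1$; (2) no $0$ has both a $1$ above it in its column and a $1$ to its left in its row; (3) if a diagonal cell contains $0$ then every cell of its row contains $0$. The boundary steps of the shifted diagram are those of the underlying Ferrers diagram. Let $\mathcal{B}_n$ be the set of such tableaux with uniform probability measure $\mathbb{P}_n$ and expectation $\mathbb{E}_n$.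
   Formalization: The inserted rows have lengths 1, 2, …, c from top to bottom (longest next to the Ferrers diagram), not c, …, 1 as stated: the stated order gives 52 tableaux and expectation 25/26 at n = 3 instead of 7/8. Columns of height 0 are allowed. -}

module Defs where

open import Data.Empty using (⊥-elim)
open import Data.Fin using (Fin; zero; suc; toℕ)
open import Data.Fin.Patterns using (0F; 1F)
open import Data.Fin.Properties using (all?; any?; ¬Fin0) renaming (_≟_ to _≟F_)
open import Data.Integer using (+_)
open import Data.List using (List; []; _∷_; _++_; length; lookup; map; filter; allFin; applyUpTo; concatMap; cartesianProductWith)
open import Data.List.Membership.Propositional using (_∈_)
open import Data.List.Membership.Propositional.Properties using (∈-lookup; ∈-allFin; ∈-map⁺; ∈-map⁻; ∈-filter⁺; ∈-filter⁻; ∈-concatMap⁺; ∈-cartesianProductWith⁺)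
import Data.List.Relation.Unary.All as All
import Data.List.Relation.Unary.All.Properties as AllP
import Data.List.Relation.Unary.AllPairs as AllPairs
import Data.List.Relation.Unary.AllPairs.Properties as AllPairsP
open import Data.List.Relation.Unary.All using (All; []; _∷_)
open import Data.List.Relation.Unary.Any using (here; there)
import Data.List.Relation.Unary.Any as Any
open import Data.List.Relation.Unary.Unique.Propositional using (Unique; []; _∷_)
import Data.List.Relation.Unary.Unique.Propositional.Properties as UniqueP
open import Data.Nat using (ℕ; zero; suc; _+_; _*_; _<_; _≤_; s≤s; NonZero)
open import Data.Nat.Properties using (_≟_; _<?_)
open import Data.Nat.ListAction using (sum)
open import Data.Product using (Σ-syntax; ∃-syntax; _×_; _,_; proj₂)
open import Data.Rational using (ℚ; _/_)
open import Data.Vec using (Vec; []; _∷_)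
import Data.Vec as Vec
open import Function.Bundles using (_⇔_; mk⇔)
open import Relation.Nullary using (Dec; yes; no; ¬_)
open import Relation.Nullary.Decidable using (_×-dec_; _→-dec_; ¬?; map′)
open import Relation.Binary.Definitions using (DecidableEquality)
open import Relation.Binary.PropositionalEquality using (_≡_; refl; subst)

data Step : Set where
  south west : Step

_≟S_ : DecidableEquality Step
south ≟S south = yes refl
south ≟S west  = no λ ()
west  ≟S south = no λ ()
west  ≟S west  = yes refl

-- A Ferrers diagram of half-perimeter n, given by its southeast boundary read
-- from the northeast corner to the southwest corner.  All 2ⁿ words occur: rows
-- of length 0 are trailing south steps, columns of height 0 leading west steps.
FerrersDiagram : ℕ → Set
FerrersDiagram n = Vec Step n

columns : ∀ {n} → FerrersDiagram n → ℕ
columns []          = 0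
columns (south ∷ w) = columns w
columns (west  ∷ w) = suc (columns w)

-- From top to bottom: the row ending at a south step has one cell in each
-- column whose west step comes later on the boundary.
rowLengths : ∀ {n} → FerrersDiagram n → List ℕ
rowLengths []          = []
rowLengths (south ∷ w) = columns w ∷ rowLengths w
rowLengths (west  ∷ w) = rowLengths w

-- The c inserted rows, listed from top to bottom, have lengths 1, 2, …, c: the
-- rows of lengths c, c-1, …, 1 are stacked in this order above the diagram, so
-- the longest one is adjacent to it.  With the reverse vertical order the
-- numbers of tableaux of size n would not be 2ⁿ n!.
shiftedRowLengths : ∀ {n} → FerrersDiagram n → List ℕ
shiftedRowLengths w = applyUpTo suc (columns w) ++ rowLengths w

-- Fillings with 0's and 1's of the left-justified diagram with the given row
-- lengths.
Filling : List ℕ → Set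
Filling = All (Vec (Fin 2))

module _ {rows : List ℕ} (T : Filling rows) where

  entry : (i : Fin (length rows)) → Fin (lookup rows i) → Fin 2
  entry i j = Vec.lookup (All.lookup T (∈-lookup i)) j

  OneAbove : (i : Fin (length rows)) → Fin (lookup rows i) → Set
  OneAbove i j = ∃[ i′ ] ∃[ j′ ] toℕ i′ < toℕ i × toℕ j′ ≡ toℕ j × entry i′ j′ ≡ 1F

  OneLeft : (i : Fin (length rows)) → Fin (lookup rows i) → Set
  OneLeft i j = ∃[ j′ ] toℕ j′ < toℕ j × entry i j′ ≡ 1F

-- The diagonal cells are the last cells of the first c rows.
record IsTableau {n} (w : FerrersDiagram n) (T : Filling (shiftedRowLengths w)) : Set where
  field
    column-has-1 : ∀ (k : Fin (columns w)) →
                   ∃[ i ] ∃[ j ] toℕ j ≡ toℕ k × entry T i j ≡ 1F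
    no-bad-0     : ∀ i j → entry T i j ≡ 0F → ¬ (OneAbove T i j × OneLeft T i j)
    diagonal-0   : ∀ i j → toℕ i < columns w → suc (toℕ j) ≡ lookup (shiftedRowLengths w) i →
                   entry T i j ≡ 0F → ∀ j′ → entry T i j′ ≡ 0F

isTableau? : ∀ {n} (w : FerrersDiagram n) (T : Filling (shiftedRowLengths w)) → Dec (IsTableau w T)
isTableau? w T =
  map′ (λ (p , q , r) → record { column-has-1 = p ; no-bad-0 = q ; diagonal-0 = r })
       (λ t → IsTableau.column-has-1 t , IsTableau.no-bad-0 t , IsTableau.diagonal-0 t)
       (column? ×-dec no-bad? ×-dec diagonal?)
  where
  column?   = all? λ k → any? λ i → any? λ j → (toℕ j ≟ toℕ k) ×-dec (entry T i j ≟F 1F)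
  above?    = λ i j → any? λ i′ → any? λ j′ →
                (toℕ i′ <? toℕ i) ×-dec (toℕ j′ ≟ toℕ j) ×-dec (entry T i′ j′ ≟F 1F)
  left?     = λ i (j : Fin (lookup (shiftedRowLengths w) i)) → any? λ j′ →
                (toℕ j′ <? toℕ j) ×-dec (entry T i j′ ≟F 1F)
  no-bad?   = all? λ i → all? λ j →
                (entry T i j ≟F 0F) →-dec ¬? (above? i j ×-dec left? i j)
  diagonal? = all? λ i → all? λ j →
                (toℕ i <? columns w) →-dec
                (suc (toℕ j) ≟ lookup (shiftedRowLengths w) i) →-dec
                (entry T i j ≟F 0F) →-dec
                all? λ j′ → entry T i j′ ≟F 0F

FilledDiagram : ℕ → Set
FilledDiagram n = Σ[ w ∈ FerrersDiagram n ] Filling (shiftedRowLengths w)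

IsTypeB : ∀ {n} → FilledDiagram n → Set
IsTypeB (w , T) = IsTableau w T

isTypeB? : ∀ {n} (t : FilledDiagram n) → Dec (IsTypeB t)
isTypeB? (w , T) = isTableau? w T

vectors : ∀ {A : Set} → List A → ∀ n → List (Vec A n)
vectors xs zero    = [] ∷ []
vectors xs (suc n) = cartesianProductWith _∷_ xs (vectors xs n)

steps : List Step
steps = south ∷ west ∷ []

fillings : ∀ rows → List (Filling rows)
fillings []         = [] ∷ []
fillings (l ∷ rows) = cartesianProductWith _∷_ (vectors (allFin 2) l) (fillings rows)

filledDiagrams : ∀ n → List (FilledDiagram n)
filledDiagrams n =
  concatMap (λ w → map (w ,_) (fillings (shiftedRowLengths w))) (vectors steps n)

-- The finite set 𝓑ₙ as a list; ∈-tableaux and tableaux-unique show that every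
-- type-B permutation tableau of size n is listed exactly once.
tableaux : ∀ n → List (FilledDiagram n)
tableaux n = filter isTypeB? (filledDiagrams n)

∈-vectors : ∀ {A : Set} {xs : List A} → (∀ x → x ∈ xs) → ∀ {n} (v : Vec A n) → v ∈ vectors xs n
∈-vectors h []      = here refl
∈-vectors h (x ∷ v) = ∈-cartesianProductWith⁺ _∷_ (h x) (∈-vectors h v)

∈-steps : ∀ s → s ∈ steps
∈-steps south = here refl
∈-steps west  = there (here refl)

∈-fillings : ∀ {rows} (T : Filling rows) → T ∈ fillings rows
∈-fillings []      = here refl
∈-fillings (r ∷ T) = ∈-cartesianProductWith⁺ _∷_ (∈-vectors ∈-allFin r) (∈-fillings T)

∈-filledDiagrams : ∀ {n} (t : FilledDiagram n) → t ∈ filledDiagrams n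
∈-filledDiagrams (w , T) =
  ∈-concatMap⁺ (λ w → map (w ,_) (fillings (shiftedRowLengths w)))
    (Any.map (λ { refl → ∈-map⁺ (w ,_) (∈-fillings T) }) (∈-vectors ∈-steps w))

∈-tableaux : ∀ {n} (t : FilledDiagram n) → t ∈ tableaux n ⇔ IsTypeB t
∈-tableaux {n} t = mk⇔ (λ p → proj₂ (∈-filter⁻ isTypeB? {xs = filledDiagrams n} p))
                       (∈-filter⁺ isTypeB? (∈-filledDiagrams t))

vectors-unique : ∀ {A : Set} {xs : List A} → Unique xs → ∀ n → Unique (vectors xs n)
vectors-unique u zero    = [] ∷ []
vectors-unique u (suc n) =
  UniqueP.cartesianProductWith⁺ _∷_ (λ { refl → refl , refl }) u (vectors-unique u n)

fillings-unique : ∀ rows → Unique (fillings rows)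
fillings-unique []         = [] ∷ []
fillings-unique (l ∷ rows) =
  UniqueP.cartesianProductWith⁺ _∷_ (λ { refl → refl , refl })
    (vectors-unique (UniqueP.allFin⁺ 2) l) (fillings-unique rows)

filledDiagrams-unique : ∀ n → Unique (filledDiagrams n)
filledDiagrams-unique n = UniqueP.concat⁺
  (AllP.map⁺ (All.universal (λ w → UniqueP.map⁺ (λ { refl → refl }) (fillings-unique _)) _))
  (AllPairsP.map⁺ (AllPairs.map disjoint (vectors-unique (((λ ()) ∷ []) ∷ [] ∷ []) n)))
  where
  disjoint : ∀ {w w′ : FerrersDiagram n} → ¬ w ≡ w′ → ∀ {t} →
             ¬ (t ∈ map (w ,_) (fillings _) × t ∈ map (w′ ,_) (fillings _))
  disjoint {w} {w′} w≢w′ (p , q) with ∈-map⁻ (w ,_) p | ∈-map⁻ (w′ ,_) q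
  ... | _ , _ , refl | _ , _ , refl = w≢w′ refl

tableaux-unique : ∀ n → Unique (tableaux n)
tableaux-unique n = UniqueP.filter⁺ isTypeB? (filledDiagrams-unique n)

-- 𝓑ₙ is nonempty: it contains the tableau with n empty rows and no columns.
columns-south : ∀ n → columns (Vec.replicate n south) ≡ 0
columns-south zero    = refl
columns-south (suc n) = columns-south n

noColumns⇒empty : ∀ {n} (w : FerrersDiagram n) → columns w ≡ 0 →
                  ∀ (i : Fin (length (rowLengths w))) → ¬ Fin (lookup (rowLengths w) i)
noColumns⇒empty (south ∷ w) p zero    j = ¬Fin0 (subst Fin p j)
noColumns⇒empty (south ∷ w) p (suc i) j = noColumns⇒empty w p i j

emptyTableau : ∀ {n} (w : FerrersDiagram n) → columns w ≡ 0 → ∀ T → IsTableau w T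
emptyTableau w p T = record
  { column-has-1 = λ k → ⊥-elim (¬Fin0 (subst Fin p k))
  ; no-bad-0     = λ i j → ⊥-elim (¬cell i j)
  ; diagonal-0   = λ i j → ⊥-elim (¬cell i j)
  }
  where
  ¬cell : ∀ i → ¬ Fin (lookup (shiftedRowLengths w) i)
  ¬cell rewrite p = noColumns⇒empty w p

∈⇒length≢0 : ∀ {A : Set} {x : A} {xs} → x ∈ xs → NonZero (length xs)
∈⇒length≢0 (here _)  = _
∈⇒length≢0 (there _) = _

tableaux≢0 : ∀ n → NonZero (length (tableaux n))
tableaux≢0 n = ∈⇒length≢0
  (∈-filter⁺ isTypeB? (∈-filledDiagrams (w , T)) (emptyTableau w (columns-south n) T))
  where
  w = Vec.replicate n south
  T : Filling (shiftedRowLengths w)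
  T = All.universal (λ l → Vec.replicate l 0F) _

𝔼 : ∀ n → (FilledDiagram n → ℕ) → ℚ
𝔼 n X = _/_ (+ sum (map X (tableaux n))) (length (tableaux n)) {{tableaux≢0 n}}

-- Positions are counted from 0, so k : Fin n is the (k+1)-th step; the
-- existence of a preceding step i excludes the first one.
WestWest : ∀ {n} → FerrersDiagram n → Fin n → Set
WestWest w k = ∃[ i ] suc (toℕ i) ≡ toℕ k × Vec.lookup w i ≡ west × Vec.lookup w k ≡ west

westWest? : ∀ {n} (w : FerrersDiagram n) (k : Fin n) → Dec (WestWest w k)
westWest? w k = any? λ i →
  (suc (toℕ i) ≟ toℕ k) ×-dec (Vec.lookup w i ≟S west) ×-dec (Vec.lookup w k ≟S west)

westWestCount : ∀ {n} → FilledDiagram n → ℕ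
westWestCount {n} (w , _) = length (filter (westWest? w) (allFin n))

2*n≢0 : ∀ {n} → 2 ≤ n → NonZero (2 * n)
2*n≢0 (s≤s _) = _

{-# OPTIONS --safe #-}
module Submission where

-- Call a row unrestricted if a 1 may be placed to the left of it.  Let G(z) be
-- the sum of z ^ #unrestricted rows over the tableaux with a given boundary.  A
-- final south step turns G(z) into z G(z).  A final west step adds a full column
-- on the left, whose 1's lie in unrestricted rows or in the new diagonal cell and
-- below whose first 1 only the rows receiving a 1 stay unrestricted; this turns
-- G(z) into 2 z G(z + 1) - z G(z).  So one step of either kind maps G(z) to
-- 2 z G(z + 1), and the n-step total is 2ⁿ z (z + 1) … (z + n - 1).  Summing over
-- the position of two consecutive west steps and setting z = 1 gives the count.

open import Defs
open import Data.Bool using (Bool; true; false; if_then_else_; _∧_; not; T)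
open import Data.Bool.Properties using (T?)
open import Data.Fin using (Fin; zero; suc; toℕ; fromℕ<)
open import Data.Fin.Patterns using (0F; 1F)
open import Data.Fin.Properties using (toℕ<n; toℕ-fromℕ<; toℕ-injective)
open import Data.Integer using (ℤ; +_; 0ℤ; 1ℤ; -_; _+_; _-_; _*_)
open import Data.Integer.Properties
  using (+-identityˡ; +-identityʳ; +-assoc; *-zeroʳ; *-identityʳ; *-identityˡ; pos-*)
open import Data.Integer.Tactic.RingSolver using (solve-∀)
open import Data.List
  using (List; []; _∷_; _++_; length; lookup; map; filter; concatMap; allFin; tabulate;
         applyUpTo; cartesianProductWith)
open import Data.List.Properties using (map-++; map-applyUpTo; ++-assoc)
open import Data.List.Relation.Unary.All using ([]; _∷_)
open import Data.Maybe using (Maybe; just; nothing)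
open import Data.Maybe.Properties using (just-injective)
open import Data.Nat using (ℕ; zero; suc; _<_; _≤_; NonZero; s≤s; s<s; z<s; s≤s⁻¹; s<s⁻¹)
import Data.Nat as ℕ
import Data.Nat.Properties as ℕ
open import Data.Nat.ListAction using (sum)
open import Data.Product using (∃-syntax; _×_; _,_; proj₁; proj₂)
open import Data.Rational using (_/_) renaming (_+_ to _+ℚ_)
import Data.Rational.Properties as ℚ
open import Data.Rational.Unnormalised using (mkℚᵘ; *≡*)
import Data.Rational.Unnormalised.Properties as ℚᵘ
open import Data.Sum using (_⊎_; inj₁; inj₂)
open import Data.Unit using (tt)
open import Data.Vec using (Vec; []; _∷_; _∷ʳ_; toList; reverse)
import Data.Vec as Vec
open import Data.Vec.Properties using (reverse-∷; toList-∷ʳ; toList-map)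
open import Function using (_∘_)
open import Function.Bundles using (mk⇔)
open import Level using (0ℓ)
open import Relation.Nullary using (Dec; yes; ¬_; does; contradiction)
open import Relation.Nullary.Decidable
  using (_×-dec_; map′; dec-true; dec-false; does-⇔)
open import Relation.Unary using (Pred; Decidable)
open import Relation.Binary.PropositionalEquality
  using (_≡_; _≢_; refl; sym; trans; cong; cong₂; module ≡-Reasoning)
open ≡-Reasoning

-- The variable z has to be carried along: the value at z = 1 after a west step involves the value
-- at z = 2 before it. For a single boundary word the west rule has a negative term, hence sums in
-- the integers. This term cancels when both kinds of step are allowed but survives when a west step
-- is prescribed, and two prescribed west steps bring in values at z, z + 1 and z + 2. For the total
-- T over all n-step words, z T(z + 1) = (z + n) T(z) turns these into a multiple of T(z). Along the
-- recursion z grows by one while n drops by one, so z + n is constant and the count becomes a sum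
-- of quadratic terms.
--
-- The other obstacle is the data: a new left column lengthens every row and puts a diagonal row on
-- top, so positions typed by row lengths would have to be transported at every step. With partial
-- matrices the old cells merely shift by one in both indices, which keeps the diagonal on the
-- positions (i , i).

at : ∀ {A : Set} {n} → Vec A n → ℕ → Maybe A
at []      _       = nothing
at (x ∷ _) zero    = just x
at (_ ∷ v) (suc i) = at v i

at-just⇒< : ∀ {A : Set} {n} (v : Vec A n) {i x} → at v i ≡ just x → i < n
at-just⇒< (_ ∷ v) {zero}  _ = z<s
at-just⇒< (_ ∷ v) {suc i} p = s<s (at-just⇒< v p)

<⇒at-just : ∀ {A : Set} {n} (v : Vec A n) {i} → i < n → ∃[ x ] at v i ≡ just x
<⇒at-just (x ∷ v) {zero}  _ = x , refl
<⇒at-just (_ ∷ v) {suc i} p = <⇒at-just v (s<s⁻¹ p)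

at-lookup : ∀ {A : Set} {n} (v : Vec A n) i → at v (toℕ i) ≡ just (Vec.lookup v i)
at-lookup (x ∷ v) zero    = refl
at-lookup (x ∷ v) (suc i) = at-lookup v i

lookup-at : ∀ {A : Set} {n} (v : Vec A n) {j x} → at v j ≡ just x →
            ∃[ k ] toℕ k ≡ j × Vec.lookup v k ≡ x
lookup-at (x ∷ v) {zero}  p = zero , refl , just-injective p
lookup-at (x ∷ v) {suc j} p with lookup-at v p
... | k , refl , q = suc k , refl , q

at-∷ʳ : ∀ {A : Set} {n} (v : Vec A n) x {i y} → at (v ∷ʳ x) i ≡ just y →
        at v i ≡ just y ⊎ (i ≡ n × x ≡ y)
at-∷ʳ []      x {zero}  refl = inj₂ (refl , refl)
at-∷ʳ (_ ∷ v) x {zero}  p = inj₁ p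
at-∷ʳ (_ ∷ v) x {suc i} p with at-∷ʳ v x {i} p
... | inj₁ q          = inj₁ q
... | inj₂ (refl , q) = inj₂ (refl , q)

at-∷ʳ-init : ∀ {A : Set} {n} (v : Vec A n) x {i y} → at v i ≡ just y → at (v ∷ʳ x) i ≡ just y
at-∷ʳ-init (_ ∷ v) x {zero}  p = p
at-∷ʳ-init (_ ∷ v) x {suc i} p = at-∷ʳ-init v x {i} p

at-∷ʳ-last : ∀ {A : Set} {n} (v : Vec A n) x → at (v ∷ʳ x) n ≡ just x
at-∷ʳ-last []      x = refl
at-∷ʳ-last (_ ∷ v) x = at-∷ʳ-last v x

-- Tableau conditions on partial matrices

-- A filling as an infinite matrix, with nothing outside the diagram.
Matrix : Set
Matrix = ℕ → ℕ → Maybe (Fin 2)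

cell : ∀ {rows} → Filling rows → Matrix
cell []      _       _ = nothing
cell (r ∷ _) zero    j = at r j
cell (_ ∷ T) (suc i) j = cell T i j

-- The diagonal cells sit at the positions (i , i) with i < c.
record Tableau (c : ℕ) (m : Matrix) : Set where
  field
    column   : ∀ {k} → k < c → ∃[ i ] m i k ≡ just 1F
    no-bad   : ∀ {i j i′ j′} → i′ < i → j′ < j →
               m i j ≡ just 0F → m i′ j ≡ just 1F → m i j′ ≢ just 1F
    diagonal : ∀ {i j} → i < c → m i i ≡ just 0F → m i j ≢ just 1F

-- The rows in which a 1 may be placed in a new leftmost column.
record Unrestricted (c : ℕ) (m : Matrix) (i : ℕ) : Set where
  field
    no-1-above  : ∀ {i′ j} → i′ < i → m i j ≡ just 0F → m i′ j ≢ just 1F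
    diagonal≢0 : i < c → m i i ≢ just 0F

open Tableau
open Unrestricted

Tableau-resp : ∀ {c m m′} → (∀ i j → m i j ≡ m′ i j) → Tableau c m → Tableau c m′
Tableau-resp e t .column k<c with t .column k<c
... | i , p = i , trans (sym (e i _)) p
Tableau-resp e t .no-bad i′<i j′<j p q r =
  t .no-bad i′<i j′<j (trans (e _ _) p) (trans (e _ _) q) (trans (e _ _) r)
Tableau-resp e t .diagonal i<c p q = t .diagonal i<c (trans (e _ _) p) (trans (e _ _) q)

Unrestricted-resp : ∀ {c m m′ i} → (∀ i j → m i j ≡ m′ i j) →
                    Unrestricted c m i → Unrestricted c m′ i
Unrestricted-resp e u .no-1-above i′<i p q =
  u .no-1-above i′<i (trans (e _ _) p) (trans (e _ _) q)
Unrestricted-resp e u .diagonal≢0 i<c p = u .diagonal≢0 i<c (trans (e _ _) p)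

cell-entry : ∀ {rows} (F : Filling rows) (i : Fin (length rows)) (j : Fin (lookup rows i)) →
             cell F (toℕ i) (toℕ j) ≡ just (entry F i j)
cell-entry (r ∷ F) zero    j = at-lookup r j
cell-entry (r ∷ F) (suc i) j = cell-entry F i j

entry-cell : ∀ {rows} (F : Filling rows) {a b x} → cell F a b ≡ just x →
             ∃[ i ] ∃[ j ] toℕ i ≡ a × toℕ j ≡ b × entry F i j ≡ x
entry-cell (r ∷ F) {zero}  p with lookup-at r p
... | j , q , e = zero , j , refl , q , e
entry-cell (r ∷ F) {suc a} p with entry-cell F {a} p
... | i , j , refl , q , e = suc i , j , refl , q , e

lookup-applyUpTo-++ : ∀ (f : ℕ → ℕ) c ys i → toℕ i < c →
                      lookup (applyUpTo f c ++ ys) i ≡ f (toℕ i)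
lookup-applyUpTo-++ f (suc c) ys zero    _ = refl
lookup-applyUpTo-++ f (suc c) ys (suc i) p = lookup-applyUpTo-++ (f ∘ suc) c ys i (s<s⁻¹ p)

0F≢1F : ∀ {x : Fin 2} → x ≡ 0F → x ≢ 1F
0F≢1F refl ()

≢1F⇒≡0F : ∀ {x : Fin 2} → x ≢ 1F → x ≡ 0F
≢1F⇒≡0F {0F} _ = refl
≢1F⇒≡0F {1F} p = contradiction refl p

module _ {n} (w : FerrersDiagram n) (F : Filling (shiftedRowLengths w)) where

  private
    cell-entry-at : ∀ {x} i j → entry F i j ≡ x → cell F (toℕ i) (toℕ j) ≡ just x
    cell-entry-at i j p = trans (cell-entry F i j) (cong just p)

    entry-cell-at : ∀ {x} i j → cell F (toℕ i) (toℕ j) ≡ just x → entry F i j ≡ x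
    entry-cell-at i j p = just-injective (trans (sym (cell-entry F i j)) p)

    -- With lengths 1, 2, ..., c from top to bottom, the last cell of the inserted row `i` lies in
    -- column `i`; this is why `Tableau` can speak of `m i i`.
    row-length : ∀ i → toℕ i < columns w → lookup (shiftedRowLengths w) i ≡ suc (toℕ i)
    row-length = lookup-applyUpTo-++ suc (columns w) (rowLengths w)

  IsTableau⇒Tableau : IsTableau w F → Tableau (columns w) (cell F)
  IsTableau⇒Tableau t .column {k} k<c
    with IsTableau.column-has-1 t (fromℕ< k<c)
  ... | i , j , p , q = toℕ i ,
    trans (cong (cell F (toℕ i)) (sym (trans p (toℕ-fromℕ< k<c)))) (cell-entry-at i j q)
  IsTableau⇒Tableau t .no-bad {i} {j} {i′} {j′} i′<i j′<j p q r
    with entry-cell F {i} {j} p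
  ... | a , b , refl , refl , e with entry-cell F {i′} q | entry-cell F {i} {j′} r
  ...   | a₁ , b₁ , refl , d₁ , e₁ | a₂ , b₂ , d₂ , refl , e₂ with toℕ-injective d₂
  ...     | refl = IsTableau.no-bad-0 t a b e ((a₁ , b₁ , i′<i , d₁ , e₁) , (b₂ , j′<j , e₂))
  IsTableau⇒Tableau t .diagonal {i} {j} i<c p q
    with entry-cell F {i} {i} p
  ... | a , b , refl , d , e with entry-cell F {toℕ a} {j} q
  ...   | a₁ , b₁ , d₁ , refl , e₁ with toℕ-injective d₁
  ...     | refl = 0F≢1F (IsTableau.diagonal-0 t a b i<c
                           (trans (cong suc d) (sym (row-length a i<c))) e b₁) e₁

  Tableau⇒IsTableau : Tableau (columns w) (cell F) → IsTableau w F
  Tableau⇒IsTableau t .IsTableau.column-has-1 k with t .column (toℕ<n k)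
  ... | a , p with entry-cell F {a} p
  ...   | i , j , _ , d , e = i , j , d , e
  Tableau⇒IsTableau t .IsTableau.no-bad-0 i j p ((i₁ , j₁ , lt₁ , d₁ , e₁) , (j₂ , lt₂ , e₂)) =
    t .no-bad lt₁ lt₂ (cell-entry-at i j p)
      (trans (cong (cell F (toℕ i₁)) (sym d₁)) (cell-entry-at i₁ j₁ e₁)) (cell-entry-at i j₂ e₂)
  Tableau⇒IsTableau t .IsTableau.diagonal-0 i j i<c d p j′ = ≢1F⇒≡0F λ q →
    t .diagonal i<c
      (trans (cong (cell F (toℕ i)) (sym (ℕ.suc-injective (trans d (row-length i i<c)))))
             (cell-entry-at i j p))
      (cell-entry-at i j′ q)

-- Growing a tableau by one boundary step

-- Boundary words are read backwards from here on, so that the head of u is the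
-- last step of the boundary; there is one row for every step.
rowsR : ∀ {n} → Vec Step n → Vec ℕ n
rowsR []          = []
rowsR (south ∷ u) = rowsR u ∷ʳ 0
rowsR (west  ∷ u) = 1 ∷ Vec.map suc (rowsR u)

init : ∀ {n} (rows : Vec ℕ n) → Filling (toList (rows ∷ʳ 0)) → Filling (toList rows)
init []         _       = []
init (l ∷ rows) (r ∷ F) = r ∷ init rows F

cell-init : ∀ {n} (rows : Vec ℕ n) F i j → cell (init rows F) i j ≡ cell F i j
cell-init []         ([] ∷ []) zero    j = refl
cell-init []         ([] ∷ []) (suc i) j = refl
cell-init (l ∷ rows) (r ∷ F)   zero    j = refl
cell-init (l ∷ rows) (r ∷ F)   (suc i) j = cell-init rows F i j

cell-last : ∀ {n} (rows : Vec ℕ n) F j → cell {toList (rows ∷ʳ 0)} F n j ≡ nothing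
cell-last []         ([] ∷ []) j = refl
cell-last (l ∷ rows) (r ∷ F)   j = cell-last rows F j

heads : ∀ {n} (rows : Vec ℕ n) → Filling (toList (Vec.map suc rows)) → Vec (Fin 2) n
heads []         _             = []
heads (l ∷ rows) ((x ∷ r) ∷ F) = x ∷ heads rows F

tails : ∀ {n} (rows : Vec ℕ n) → Filling (toList (Vec.map suc rows)) → Filling (toList rows)
tails []         _             = []
tails (l ∷ rows) ((x ∷ r) ∷ F) = r ∷ tails rows F

-- The new diagonal row has the single cell `x`, the old rows receive `col` on their left, and the
-- old cell (i , j) moves to (i + 1 , j + 1), so diagonal cells stay diagonal.
extend : ∀ {n} → Fin 2 → Vec (Fin 2) n → Matrix → Matrix
extend x col m zero    zero    = just x
extend x col m zero    (suc j) = nothing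
extend x col m (suc i) zero    = at col i
extend x col m (suc i) (suc j) = m i j

cell-extend : ∀ {n} (rows : Vec ℕ n) x F i j →
              extend x (heads rows F) (cell (tails rows F)) i j ≡ cell ((x ∷ []) ∷ F) i j
cell-extend rows x F zero    zero    = refl
cell-extend rows x F zero    (suc j) = refl
cell-extend rows x F (suc i) zero    = go rows F i
  where
  go : ∀ {n} (rows : Vec ℕ n) F i → at (heads rows F) i ≡ cell F i 0
  go []         []            i       = refl
  go (l ∷ rows) ((x ∷ r) ∷ F) zero    = refl
  go (l ∷ rows) ((x ∷ r) ∷ F) (suc i) = go rows F i
cell-extend rows x F (suc i) (suc j) = go rows F i
  where
  go : ∀ {n} (rows : Vec ℕ n) F i → cell (tails rows F) i j ≡ cell F i (suc j)
  go []         []            i       = refl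
  go (l ∷ rows) ((x ∷ r) ∷ F) zero    = refl
  go (l ∷ rows) ((x ∷ r) ∷ F) (suc i) = go rows F i

isOne : Fin 2 → Bool
isOne 0F = false
isOne 1F = true

-- A new leftmost column consists of a cell above a given column col; the flags
-- b mark the unrestricted rows, and s says whether a 1 occurs further up.
admissible : ∀ {n} → Bool → Vec Bool n → Vec (Fin 2) n → Bool
admissible s []      []         = s
admissible s (f ∷ b) (0F ∷ col) = admissible s b col
admissible s (f ∷ b) (1F ∷ col) = f ∧ admissible true b col

-- A new 0 with a 1 above it forbids every later 1 to its left, so its row loses the flag; a row
-- that receives a 1 gains no such obstruction.
refine : ∀ {n} → Bool → Vec Bool n → Vec (Fin 2) n → Vec Bool n
refine s []      []         = []
refine s (f ∷ b) (0F ∷ col) = (f ∧ not s) ∷ refine s b col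
refine s (f ∷ b) (1F ∷ col) = f ∷ refine true b col

Admissible : ∀ {n} → Bool → Vec Bool n → Vec (Fin 2) n → Set
Admissible s b col = (T s ⊎ ∃[ i ] at col i ≡ just 1F) ×
                     (∀ {i} → at col i ≡ just 1F → at b i ≡ just true)

admissible⇒ : ∀ {n} s (b : Vec Bool n) col → T (admissible s b col) → Admissible s b col
admissible⇒ s []      []         p = inj₁ p , λ ()
admissible⇒ s (f ∷ b) (0F ∷ col) p with admissible⇒ s b col p
... | q , h = shift q , λ { {suc i} → h }
  where
  shift : (T s ⊎ ∃[ i ] at col i ≡ just 1F) → T s ⊎ ∃[ i ] at (0F ∷ col) i ≡ just 1F
  shift (inj₁ t)       = inj₁ t
  shift (inj₂ (i , e)) = inj₂ (suc i , e)
admissible⇒ s (true ∷ b) (1F ∷ col) p =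
  inj₂ (0 , refl) , λ { {zero} _ → refl ; {suc i} → proj₂ (admissible⇒ true b col p) }

admissible⇐ : ∀ {n} s (b : Vec Bool n) col → Admissible s b col → T (admissible s b col)
admissible⇐ s []      []            (inj₁ t , _) = t
admissible⇐ s (f ∷ b) (0F ∷ col)    (inj₁ t , h) = admissible⇐ s b col (inj₁ t , λ {i} → h {suc i})
admissible⇐ s (f ∷ b) (0F ∷ col)    (inj₂ (suc i , e) , h) =
  admissible⇐ s b col (inj₂ (i , e) , λ {i} → h {suc i})
admissible⇐ s (true ∷ b)  (1F ∷ col) (_ , h) = admissible⇐ true b col (inj₁ tt , λ {i} → h {suc i})
admissible⇐ s (false ∷ b) (1F ∷ col) (_ , h) with h {0} refl
... | ()

Kept : ∀ {n} → Bool → Vec (Fin 2) n → ℕ → Set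
Kept s col i = at col i ≡ just 1F ⊎ (¬ T s × (∀ {i′} → i′ < i → at col i′ ≢ just 1F))

refine⇒ : ∀ {n} s (b : Vec Bool n) col {i} → at (refine s b col) i ≡ just true →
          at b i ≡ just true × Kept s col i
refine⇒ s     []         []         ()
refine⇒ s     (f ∷ b)    (1F ∷ col) {zero}  p = p , inj₁ refl
refine⇒ s     (f ∷ b)    (1F ∷ col) {suc i} p with refine⇒ true b col {i} p
... | q , inj₁ e       = q , inj₁ e
... | q , inj₂ (t , _) = contradiction tt t
refine⇒ false (true ∷ b) (0F ∷ col) {zero}  p = refl , inj₂ ((λ ()) , λ ())
refine⇒ true  (true ∷ b) (0F ∷ col) {zero}  ()
refine⇒ s     (f ∷ b)    (0F ∷ col) {suc i} p with refine⇒ s b col {i} p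
... | q , inj₁ e       = q , inj₁ e
... | q , inj₂ (t , h) = q , inj₂ (t , λ { {suc i′} lt → h (s<s⁻¹ lt) })

refine⇐ : ∀ {n} s (b : Vec Bool n) col {i} → at b i ≡ just true → Kept s col i →
          at (refine s b col) i ≡ just true
refine⇐ s     (f ∷ b)    (1F ∷ col) {zero}  p _              = p
refine⇐ s     (f ∷ b)    (1F ∷ col) {suc i} p (inj₁ e)       = refine⇐ true b col {i} p (inj₁ e)
refine⇐ s     (f ∷ b)    (1F ∷ col) {suc i} p (inj₂ (_ , h)) = contradiction refl (h {0} z<s)
refine⇐ false (true ∷ b) (0F ∷ col) {zero}  p _              = refl
refine⇐ true  (true ∷ b) (0F ∷ col) {zero}  p (inj₂ (t , _)) = contradiction tt t
refine⇐ s     (f ∷ b)    (0F ∷ col) {suc i} p (inj₁ e)       = refine⇐ s b col {i} p (inj₁ e)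
refine⇐ s     (f ∷ b)    (0F ∷ col) {suc i} p (inj₂ (t , h)) =
  refine⇐ s b col {i} p (inj₂ (t , λ lt → h (s<s lt)))

-- The bound `i < n` is needed in one direction only: a row index outside the diagram is vacuously
-- `Unrestricted` but carries no flag.
Flags : ∀ {n} → ℕ → Matrix → Vec Bool n → Set
Flags {n} c m b = ∀ {i} → (at b i ≡ just true → Unrestricted c m i) ×
                          (i < n → Unrestricted c m i → at b i ≡ just true)

T-isOne : ∀ {x} → T (isOne x) → x ≡ 1F
T-isOne {1F} _ = refl

¬T-isOne : ∀ {x} → x ≢ 1F → ¬ T (isOne x)
¬T-isOne p t = p (T-isOne t)

module Extend {n} (c : ℕ) (m : Matrix) (b : Vec Bool n) (flags : Flags c m b)
              (x : Fin 2) (col : Vec (Fin 2) n) where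

  private
    m′ = extend x col m

  -- A 0 of the new column has nothing to its left and is never bad. Only a new 1 can do harm, to
  -- the old 0's of its row or to a diagonal 0, and both are excluded by the flag of that row.
  extend-tableau : Tableau c m × Admissible (isOne x) b col → Tableau (suc c) m′
  extend-tableau (t , inj₁ o , _) .column {zero} _ = 0 , cong just (T-isOne o)
  extend-tableau (t , inj₂ (i , e) , _) .column {zero} _ = suc i , e
  extend-tableau (t , _) .column {suc k} k<c with t .column (s<s⁻¹ k<c)
  ... | i , e = suc i , e
  extend-tableau (t , _ , h) .no-bad {suc i} {suc j} {suc i′} {zero} i′<i _ p q r =
    flags .proj₁ (h r) .no-1-above (s<s⁻¹ i′<i) p q
  extend-tableau (t , _) .no-bad {suc i} {suc j} {suc i′} {suc j′} i′<i j′<j p q r =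
    t .no-bad (s<s⁻¹ i′<i) (s<s⁻¹ j′<j) p q r
  extend-tableau (t , _) .diagonal {zero} {zero} _ refl ()
  extend-tableau (t , _ , h) .diagonal {suc i} {zero} i<c p q =
    flags .proj₁ (h q) .diagonal≢0 (s<s⁻¹ i<c) p
  extend-tableau (t , _) .diagonal {suc i} {suc j} i<c p q = t .diagonal (s<s⁻¹ i<c) p q

  -- A new 1 stands to the left of its whole old row, so an old 0 below a 1, or a diagonal 0, in
  -- that row would violate the conditions on `m′`: the row was unrestricted.
  restrict-tableau : Tableau (suc c) m′ → Tableau c m × Admissible (isOne x) b col
  restrict-tableau t = old , first (t .column z<s) , λ e → flags .proj₂ (at-just⇒< col e) (unr e)
    where
    old : Tableau c m
    old .column k<c with t .column (s<s k<c)
    ... | suc i , e = i , e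
    old .no-bad i′<i j′<j p q = t .no-bad (s<s i′<i) (s<s j′<j) p q
    old .diagonal {j = j} i<c = t .diagonal {j = suc j} (s<s i<c)

    first : ∃[ i ] m′ i 0 ≡ just 1F → T (isOne x) ⊎ ∃[ i ] at col i ≡ just 1F
    first (zero  , refl) = inj₁ tt
    first (suc i , e)    = inj₂ (i , e)

    unr : ∀ {i} → at col i ≡ just 1F → Unrestricted c m i
    unr e .no-1-above i′<i p q = t .no-bad (s<s i′<i) z<s p q e
    unr e .diagonal≢0 i<c p    = t .diagonal {j = 0} (s<s i<c) p e

  -- For an old row the only new obstruction is a 0 in the new column below a 1, where `x` counts as
  -- above the rest. The top row has nothing above it and is unrestricted exactly when its diagonal
  -- cell `x` is 1.
  extend-flags : Flags (suc c) m′ (isOne x ∷ refine (isOne x) b col)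
  extend-flags {zero} .proj₁ _ .no-1-above ()
  extend-flags {zero} .proj₁ p .diagonal≢0 _ refl with p
  ... | ()
  extend-flags {zero} .proj₂ _ u = cong just (one (λ x≡0 → u .diagonal≢0 z<s (cong just x≡0)))
    where
    one : ∀ {y} → y ≢ 0F → isOne y ≡ true
    one {0F} p = contradiction refl p
    one {1F} _ = refl
  extend-flags {suc i} .proj₁ p = go (refine⇒ (isOne x) b col {i} p)
    where
    go : at b i ≡ just true × Kept (isOne x) col i → Unrestricted (suc c) m′ (suc i)
    go (q , k) .no-1-above {zero}   {zero}  _ r refl with k
    ... | inj₁ e       with trans (sym r) e
    ...   | ()
    go (q , k) .no-1-above {zero}   {zero}  _ r refl | inj₂ (t , _) = t tt
    go (q , k) .no-1-above {suc i′} {zero} i′<i r e with k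
    ... | inj₁ e′      with trans (sym r) e′
    ...   | ()
    go (q , k) .no-1-above {suc i′} {zero} i′<i r e | inj₂ (_ , h) = h (s<s⁻¹ i′<i) e
    go (q , k) .no-1-above {suc i′} {suc j} i′<i r e =
      flags .proj₁ q .no-1-above (s<s⁻¹ i′<i) r e
    go (q , k) .diagonal≢0 i<c = flags .proj₁ q .diagonal≢0 (s<s⁻¹ i<c)
  extend-flags {suc i} .proj₂ i<n u =
    refine⇐ (isOne x) b col {i} (flags .proj₂ (s<s⁻¹ i<n) old) (kept (<⇒at-just col (s<s⁻¹ i<n)))
    where
    old : Unrestricted c m i
    old .no-1-above {j = j} i′<i = u .no-1-above {j = suc j} (s<s i′<i)
    old .diagonal≢0 i<c  = u .diagonal≢0 (s<s i<c)

    kept : ∃[ y ] at col i ≡ just y → Kept (isOne x) col i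
    kept (1F , e) = inj₁ e
    kept (0F , e) = inj₂ ( ¬T-isOne (λ x≡1 → u .no-1-above {0} {0} z<s e (cong just x≡1))
                         , λ i′<i → u .no-1-above {_} {0} (s<s i′<i) e)

flags : ∀ {n} (u : Vec Step n) → Filling (toList (rowsR u)) → Vec Bool n
flags []          _              = []
flags (south ∷ u) F              = flags u (init (rowsR u) F) ∷ʳ true
flags (west  ∷ u) ((x ∷ []) ∷ F) =
  isOne x ∷ refine (isOne x) (flags u (tails (rowsR u) F)) (heads (rowsR u) F)

flags-correct : ∀ {n} (u : Vec Step n) (F : Filling (toList (rowsR u))) → Flags (columns u) (cell F) (flags u F)
flags-correct []          []             = (λ ()) , λ ()
flags-correct (south ∷ u) F {i} = to , from
  where
  F′ = init (rowsR u) F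

  to : at (flags u F′ ∷ʳ true) i ≡ just true → Unrestricted (columns u) (cell F) i
  to p with at-∷ʳ (flags u F′) true p
  ... | inj₁ q = Unrestricted-resp (cell-init (rowsR u) F) (flags-correct u F′ .proj₁ q)
  -- The added bottom row is empty, so both requirements hold vacuously.
  ... | inj₂ (refl , _) = λ where
    .no-1-above {_} {j} _ q → contradiction (trans (sym (cell-last (rowsR u) F j)) q) λ ()
    .diagonal≢0 _ q → contradiction (trans (sym (cell-last (rowsR u) F _)) q) λ ()

  from : i < _ → Unrestricted (columns u) (cell F) i → at (flags u F′ ∷ʳ true) i ≡ just true
  from i<1+n q with ℕ.m≤n⇒m<n∨m≡n (s≤s⁻¹ i<1+n)
  ... | inj₁ i<n  = at-∷ʳ-init (flags u F′) true
    (flags-correct u F′ .proj₂ i<n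
      (Unrestricted-resp (λ i j → sym (cell-init (rowsR u) F i j)) q))
  ... | inj₂ refl = at-∷ʳ-last (flags u F′) true
flags-correct (west  ∷ u) ((x ∷ []) ∷ F) =
    (λ p → Unrestricted-resp (cell-extend (rowsR u) x F) (extend-flags .proj₁ p))
  , λ i<n q → extend-flags .proj₂ i<n
      (Unrestricted-resp (λ i j → sym (cell-extend (rowsR u) x F i j)) q)
  where
  F′ = tails (rowsR u) F
  open Extend (columns u) (cell F′) (flags u F′) (flags-correct u F′) x (heads (rowsR u) F)

-- A second decision procedure, recursive along the boundary: for a west step its `does` computes to
-- the old verdict `∧` the `admissible` test, so the sum over fillings can be split at the new
-- column by computation alone.
tableau? : ∀ {n} (u : Vec Step n) (F : Filling (toList (rowsR u))) → Dec (Tableau (columns u) (cell F))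
tableau? [] [] = yes λ where
  .column ()
  .no-bad _ _ ()
  .diagonal ()
tableau? (south ∷ u) F =
  map′ (Tableau-resp (cell-init (rowsR u) F))
       (Tableau-resp λ i j → sym (cell-init (rowsR u) F i j))
       (tableau? u (init (rowsR u) F))
tableau? (west ∷ u) ((x ∷ []) ∷ F) =
  map′ (Tableau-resp (cell-extend (rowsR u) x F) ∘ extend-tableau)
       (restrict-tableau ∘ Tableau-resp λ i j → sym (cell-extend (rowsR u) x F i j))
       (tableau? u F′ ×-dec
        map′ (admissible⇒ (isOne x) b col) (admissible⇐ (isOne x) b col)
             (T? (admissible (isOne x) b col)))
  where
  F′ = tails (rowsR u) F
  b = flags u F′
  col = heads (rowsR u) F
  open Extend (columns u) (cell F′) b (flags-correct u F′) x col

-- Finite sums over words and fillings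

∑ : {A : Set} → List A → (A → ℤ) → ℤ
∑ []       f = 0ℤ
∑ (x ∷ xs) f = f x + ∑ xs f

module _ {A : Set} where

  ∑-cong : ∀ (xs : List A) {f g} → (∀ x → f x ≡ g x) → ∑ xs f ≡ ∑ xs g
  ∑-cong []       e = refl
  ∑-cong (x ∷ xs) e = cong₂ _+_ (e x) (∑-cong xs e)

  ∑-zero : ∀ (xs : List A) → ∑ xs (λ _ → 0ℤ) ≡ 0ℤ
  ∑-zero []       = refl
  ∑-zero (x ∷ xs) = trans (+-identityˡ _) (∑-zero xs)

  ∑-++ : ∀ (xs ys : List A) f → ∑ (xs ++ ys) f ≡ ∑ xs f + ∑ ys f
  ∑-++ []       ys f = sym (+-identityˡ _)
  ∑-++ (x ∷ xs) ys f = trans (cong (λ k → f x + k) (∑-++ xs ys f)) (sym (+-assoc (f x) _ _))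

  ∑-+ : ∀ (xs : List A) f g → ∑ xs (λ x → f x + g x) ≡ ∑ xs f + ∑ xs g
  ∑-+ []       f g = refl
  ∑-+ (x ∷ xs) f g = trans (cong (λ k → f x + g x + k) (∑-+ xs f g)) (interchange (f x) (g x) _ _)
    where
    interchange : ∀ a b c d → a + b + (c + d) ≡ a + c + (b + d)
    interchange = solve-∀

  ∑-* : ∀ (xs : List A) c f → ∑ xs (λ x → c * f x) ≡ c * ∑ xs f
  ∑-* []       c f = sym (*-zeroʳ c)
  ∑-* (x ∷ xs) c f = trans (cong (λ k → c * f x + k) (∑-* xs c f)) (factor c (f x) _)
    where
    factor : ∀ c a b → c * a + c * b ≡ c * (a + b)
    factor = solve-∀

  ∑-map : ∀ {B : Set} (h : B → A) xs f → ∑ (map h xs) f ≡ ∑ xs (f ∘ h)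
  ∑-map h []       f = refl
  ∑-map h (x ∷ xs) f = cong (λ k → f (h x) + k) (∑-map h xs f)

  ∑-concatMap : ∀ {B : Set} (h : B → List A) xs f → ∑ (concatMap h xs) f ≡ ∑ xs (λ x → ∑ (h x) f)
  ∑-concatMap h []       f = refl
  ∑-concatMap h (x ∷ xs) f =
    trans (∑-++ (h x) (concatMap h xs) f) (cong (λ k → ∑ (h x) f + k) (∑-concatMap h xs f))

  ∑-cartesianProductWith : ∀ {B C : Set} (h : B → C → A) xs ys f →
    ∑ (cartesianProductWith h xs ys) f ≡ ∑ xs (λ x → ∑ ys (λ y → f (h x y)))
  ∑-cartesianProductWith h []       ys f = refl
  ∑-cartesianProductWith h (x ∷ xs) ys f =
    trans (∑-++ (map (h x) ys) (cartesianProductWith h xs ys) f)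
          (cong₂ _+_ (∑-map (h x) ys f) (∑-cartesianProductWith h xs ys f))

  ∑-filter : ∀ {P : Pred A 0ℓ} (P? : Decidable P) xs f →
             ∑ (filter P? xs) f ≡ ∑ xs (λ x → if does (P? x) then f x else 0ℤ)
  ∑-filter P? []       f = refl
  ∑-filter P? (x ∷ xs) f with does (P? x)
  ... | true  = cong (λ k → f x + k) (∑-filter P? xs f)
  ... | false = trans (∑-filter P? xs f) (sym (+-identityˡ _))

  sum-map : ∀ (X : A → ℕ) xs → + sum (map X xs) ≡ ∑ xs (λ x → + X x)
  sum-map X []       = refl
  sum-map X (x ∷ xs) = cong (λ k → + X x + k) (sum-map X xs)

  length-∑ : ∀ (xs : List A) → + length xs ≡ ∑ xs (λ _ → 1ℤ)
  length-∑ []       = refl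
  length-∑ (x ∷ xs) = cong (λ k → 1ℤ + k) (length-∑ xs)

∑-swap : ∀ {A B : Set} (xs : List A) (ys : List B) (f : A → B → ℤ) →
         ∑ xs (λ x → ∑ ys (f x)) ≡ ∑ ys (λ y → ∑ xs (λ x → f x y))
∑-swap []       ys f = sym (∑-zero ys)
∑-swap (x ∷ xs) ys f = trans (cong (λ k → ∑ ys (f x) + k) (∑-swap xs ys f)) (sym (∑-+ ys _ _))

∑-vectors-∷ʳ : ∀ {A : Set} (xs : List A) n (f : Vec A (suc n) → ℤ) →
               ∑ (vectors xs (suc n)) f ≡ ∑ xs (λ x → ∑ (vectors xs n) (λ v → f (v ∷ʳ x)))
∑-vectors-∷ʳ xs zero    f = ∑-cartesianProductWith _∷_ xs ([] ∷ []) f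
∑-vectors-∷ʳ xs (suc n) f = begin
  ∑ (vectors xs (suc (suc n))) f
    ≡⟨ ∑-cartesianProductWith _∷_ xs (vectors xs (suc n)) f ⟩
  ∑ xs (λ y → ∑ (vectors xs (suc n)) (λ v → f (y ∷ v)))
    ≡⟨ ∑-cong xs (λ y → ∑-vectors-∷ʳ xs n (λ v → f (y ∷ v))) ⟩
  ∑ xs (λ y → ∑ xs (λ x → ∑ (vectors xs n) (λ v → f (y ∷ (v ∷ʳ x)))))
    ≡⟨ ∑-swap xs xs _ ⟩
  ∑ xs (λ x → ∑ xs (λ y → ∑ (vectors xs n) (λ v → f (y ∷ (v ∷ʳ x)))))
    ≡⟨ ∑-cong xs (λ x → sym (∑-cartesianProductWith _∷_ xs (vectors xs n) (λ v → f (v ∷ʳ x)))) ⟩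
  ∑ xs (λ x → ∑ (vectors xs (suc n)) (λ v → f (v ∷ʳ x))) ∎

-- Reversal permutes the words over `xs`. This is what allows the boundary to be read from its last
-- step.
∑-vectors-reverse : ∀ {A : Set} (xs : List A) n (f : Vec A n → ℤ) →
                    ∑ (vectors xs n) f ≡ ∑ (vectors xs n) (f ∘ reverse)
∑-vectors-reverse xs zero    f = refl
∑-vectors-reverse xs (suc n) f = begin
  ∑ (vectors xs (suc n)) f
    ≡⟨ ∑-vectors-∷ʳ xs n f ⟩
  ∑ xs (λ x → ∑ (vectors xs n) (λ v → f (v ∷ʳ x)))
    ≡⟨ ∑-cong xs (λ x → ∑-vectors-reverse xs n (λ v → f (v ∷ʳ x))) ⟩
  ∑ xs (λ x → ∑ (vectors xs n) (λ v → f (reverse v ∷ʳ x)))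
    ≡⟨ ∑-cong xs (λ x → ∑-cong (vectors xs n) (λ v → cong f (sym (reverse-∷ x v)))) ⟩
  ∑ xs (λ x → ∑ (vectors xs n) (λ v → f (reverse (x ∷ v))))
    ≡⟨ sym (∑-cartesianProductWith _∷_ xs (vectors xs n) (f ∘ reverse)) ⟩
  ∑ (vectors xs (suc n)) (f ∘ reverse) ∎

-- An empty row has exactly one filling, so removing it loses nothing.
∑-init : ∀ {n} (rows : Vec ℕ n) (g : Filling (toList rows) → ℤ) →
         ∑ (fillings (toList (rows ∷ʳ 0))) (g ∘ init rows) ≡ ∑ (fillings (toList rows)) g
∑-init []         g = refl
∑-init (l ∷ rows) g = begin
  ∑ (fillings (l ∷ toList (rows ∷ʳ 0))) (g ∘ init (l ∷ rows))
    ≡⟨ ∑-cartesianProductWith _∷_ (vectors (allFin 2) l) _ _ ⟩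
  ∑ (vectors (allFin 2) l) (λ r → ∑ (fillings (toList (rows ∷ʳ 0))) (λ F → g (r ∷ init rows F)))
    ≡⟨ ∑-cong (vectors (allFin 2) l) (λ r → ∑-init rows (λ F → g (r ∷ F))) ⟩
  ∑ (vectors (allFin 2) l) (λ r → ∑ (fillings (toList rows)) (λ F → g (r ∷ F)))
    ≡⟨ sym (∑-cartesianProductWith _∷_ (vectors (allFin 2) l) _ g) ⟩
  ∑ (fillings (l ∷ toList rows)) g ∎

-- Cutting off the first column is a bijection between fillings of the lengthened rows and pairs of
-- a column and a filling of the old rows.
∑-heads-tails : ∀ {n} (rows : Vec ℕ n) (g : Vec (Fin 2) n → Filling (toList rows) → ℤ) →
  ∑ (fillings (toList (Vec.map suc rows))) (λ F → g (heads rows F) (tails rows F)) ≡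
  ∑ (vectors (allFin 2) n) (λ col → ∑ (fillings (toList rows)) (g col))
∑-heads-tails []         g = sym (+-identityʳ _)
∑-heads-tails {suc n} (l ∷ rows) g = begin
  ∑ (fillings (suc l ∷ toList (Vec.map suc rows))) (λ F → g (heads (l ∷ rows) F) (tails (l ∷ rows) F))
    ≡⟨ ∑-cartesianProductWith _∷_ (vectors bits (suc l)) Fs _ ⟩
  ∑ (vectors bits (suc l)) (λ r → ∑ Fs (λ F → g (heads (l ∷ rows) (r ∷ F)) (tails (l ∷ rows) (r ∷ F))))
    ≡⟨ ∑-cartesianProductWith _∷_ bits (vectors bits l) _ ⟩
  ∑ bits (λ x → ∑ (vectors bits l) (λ r → ∑ Fs (λ F → g (x ∷ heads rows F) (r ∷ tails rows F))))
    ≡⟨ ∑-cong bits (λ x → ∑-cong (vectors bits l) (λ r →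
         ∑-heads-tails rows (λ col F → g (x ∷ col) (r ∷ F)))) ⟩
  ∑ bits (λ x → ∑ (vectors bits l) (λ r → ∑ (vectors bits n) (λ col →
    ∑ (fillings (toList rows)) (λ F → g (x ∷ col) (r ∷ F)))))
    ≡⟨ ∑-cong bits (λ x → ∑-swap (vectors bits l) (vectors bits n)
         (λ r col → ∑ (fillings (toList rows)) (λ F → g (x ∷ col) (r ∷ F)))) ⟩
  ∑ bits (λ x → ∑ (vectors bits n) (λ col → ∑ (vectors bits l) (λ r →
    ∑ (fillings (toList rows)) (λ F → g (x ∷ col) (r ∷ F)))))
    ≡⟨ ∑-cong bits (λ x → ∑-cong (vectors bits n) (λ col →
         sym (∑-cartesianProductWith _∷_ (vectors bits l) (fillings (toList rows)) (g (x ∷ col))))) ⟩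
  ∑ bits (λ x → ∑ (vectors bits n) (λ col → ∑ (fillings (l ∷ toList rows)) (g (x ∷ col))))
    ≡⟨ sym (∑-cartesianProductWith _∷_ bits (vectors bits n) _) ⟩
  ∑ (vectors bits (suc n)) (λ col → ∑ (fillings (l ∷ toList rows)) (g col)) ∎
  where
  bits = allFin 2
  Fs = fillings (toList (Vec.map suc rows))

-- The polynomial of one boundary word under a new step

weight : ∀ {n} → ℤ → Vec Bool n → ℤ
weight z []          = 1ℤ
weight z (true  ∷ b) = z * weight z b
weight z (false ∷ b) = weight z b

weight-∷ʳ-true : ∀ {n} z (b : Vec Bool n) → weight z (b ∷ʳ true) ≡ z * weight z b
weight-∷ʳ-true z []          = refl
weight-∷ʳ-true z (true  ∷ b) = cong (z *_) (weight-∷ʳ-true z b)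
weight-∷ʳ-true z (false ∷ b) = weight-∷ʳ-true z b

weight-1 : ∀ {n} (b : Vec Bool n) → weight 1ℤ b ≡ 1ℤ
weight-1 []          = refl
weight-1 (true  ∷ b) = trans (*-identityˡ _) (weight-1 b)
weight-1 (false ∷ b) = weight-1 b

weightIf : ∀ {n} → ℤ → Bool → Vec Bool n → ℤ
weightIf z v b = if v then weight z b else 0ℤ

weightIf-true : ∀ {n} z v (b : Vec Bool n) → weightIf z v (true ∷ b) ≡ z * weightIf z v b
weightIf-true z true  b = refl
weightIf-true z false b = sym (*-zeroʳ z)

∑-bits : ∀ {n} (f : Vec (Fin 2) (suc n) → ℤ) → ∑ (vectors (allFin 2) (suc n)) f ≡
         ∑ (vectors (allFin 2) n) (f ∘ (0F ∷_)) + ∑ (vectors (allFin 2) n) (f ∘ (1F ∷_))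
∑-bits {n} f = trans (∑-cartesianProductWith _∷_ (allFin 2) (vectors (allFin 2) n) f)
                     (cong (λ k → ∑ (vectors (allFin 2) n) (f ∘ (0F ∷_)) + k) (+-identityʳ _))

columnWeight : ∀ {n} → ℤ → Bool → Vec Bool n → Vec (Fin 2) n → ℤ
columnWeight z s b col = weightIf z (admissible s b col) (refine s b col)

-- Below a 1 the rows are independent. An unrestricted row takes a 0 and becomes restricted (factor
-- 1) or takes a 1 and stays unrestricted (factor z); a restricted row is forced to take a 0.
∑-columnWeight-true : ∀ {n} z (b : Vec Bool n) →
  ∑ (vectors (allFin 2) n) (columnWeight z true b) ≡ weight (+ 1 + z) b
∑-columnWeight-true z [] = refl
∑-columnWeight-true {suc n} z (true ∷ b) = begin
  ∑ (vectors (allFin 2) (suc n)) (columnWeight z true (true ∷ b))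
    ≡⟨ ∑-bits (columnWeight z true (true ∷ b)) ⟩
  ∑ cols (columnWeight z true b) + ∑ cols (columnWeight z true (true ∷ b) ∘ (1F ∷_))
    ≡⟨ cong₂ _+_ (∑-columnWeight-true z b) (trans
         (trans (∑-cong cols (λ col → weightIf-true z (admissible true b col) (refine true b col)))
           (∑-* cols z (columnWeight z true b)))
         (cong (z *_) (∑-columnWeight-true z b))) ⟩
  weight (+ 1 + z) b + z * weight (+ 1 + z) b
    ≡⟨ factor z (weight (+ 1 + z) b) ⟩
  (+ 1 + z) * weight (+ 1 + z) b ∎
  where
  cols = vectors (allFin 2) n
  factor : ∀ z a → a + z * a ≡ (+ 1 + z) * a
  factor = solve-∀
∑-columnWeight-true {suc n} z (false ∷ b) =
  trans (∑-bits (columnWeight z true (false ∷ b)))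
    (trans (cong₂ _+_ (∑-columnWeight-true z b) (∑-zero (vectors (allFin 2) n))) (+-identityʳ _))

-- With k unrestricted rows and the first 1 in the j-th of them, the rows above keep their factor z,
-- this row contributes z and each later one 1 + z. The sum over j of z^j (1 + z)^(k - j) telescopes
-- to z ((1 + z)^k - z^k), since the two bases differ by 1. The subtracted term is moved to the left
-- side.
∑-columnWeight-false : ∀ {n} z (b : Vec Bool n) →
  ∑ (vectors (allFin 2) n) (columnWeight z false b) + z * weight z b ≡ z * weight (+ 1 + z) b
∑-columnWeight-false z [] = +-identityˡ _
∑-columnWeight-false {suc n} z (true ∷ b) = begin
  ∑ (vectors (allFin 2) (suc n)) (columnWeight z false (true ∷ b)) + z * (z * w)
    ≡⟨ cong (_+ z * (z * w)) (∑-bits (columnWeight z false (true ∷ b))) ⟩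
  ∑ cols (columnWeight z false (true ∷ b) ∘ (0F ∷_)) +
  ∑ cols (columnWeight z false (true ∷ b) ∘ (1F ∷_)) + z * (z * w)
    ≡⟨ cong (_+ z * (z * w)) (cong₂ _+_
         (trans (∑-cong cols (λ col → weightIf-true z (admissible false b col) (refine false b col)))
           (∑-* cols z (columnWeight z false b)))
         (trans (∑-cong cols (λ col → weightIf-true z (admissible true b col) (refine true b col)))
           (trans (∑-* cols z (columnWeight z true b)) (cong (z *_) (∑-columnWeight-true z b))))) ⟩
  z * c + z * w₁ + z * (z * w)
    ≡⟨ collect z c w₁ w ⟩
  z * (c + z * w) + z * w₁
    ≡⟨ cong (λ k → z * k + z * w₁) (∑-columnWeight-false z b) ⟩
  z * (z * w₁) + z * w₁
    ≡⟨ factor z w₁ ⟩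
  z * ((+ 1 + z) * w₁) ∎
  where
  cols = vectors (allFin 2) n
  c  = ∑ cols (columnWeight z false b)
  w  = weight z b
  w₁ = weight (+ 1 + z) b
  collect : ∀ z c w₁ w → z * c + z * w₁ + z * (z * w) ≡ z * (c + z * w) + z * w₁
  collect = solve-∀
  factor : ∀ z a → z * (z * a) + z * a ≡ z * ((+ 1 + z) * a)
  factor = solve-∀
∑-columnWeight-false {suc n} z (false ∷ b) =
  trans (cong (_+ z * weight z b) (trans (∑-bits (columnWeight z false (false ∷ b)))
          (trans (cong (λ k → ∑ cols (columnWeight z false b) + k) (∑-zero cols))
            (+-identityʳ (∑ cols (columnWeight z false b))))))
        (∑-columnWeight-false z b)
  where
  cols = vectors (allFin 2) n

-- The two sums belong to a diagonal 0, where a 1 must still follow below, and to a diagonal 1,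
-- which adds an unrestricted row. Together with the third term each half yields z times the weight
-- at 1 + z. The flag `v` tells whether the old filling is a tableau.
∑-newColumn : ∀ {n} z v (b : Vec Bool n) → let cols = vectors (allFin 2) n in
  ∑ cols (λ col → weightIf z (v ∧ admissible false b col) (false ∷ refine false b col)) +
  ∑ cols (λ col → weightIf z (v ∧ admissible true b col) (true ∷ refine true b col)) +
  z * weightIf z v b ≡ + 2 * z * weightIf (+ 1 + z) v b
∑-newColumn {n} z false b = begin
  ∑ cols (λ _ → 0ℤ) + ∑ cols (λ _ → 0ℤ) + z * 0ℤ
    ≡⟨ cong (λ k → k + k + z * 0ℤ) (∑-zero cols) ⟩
  0ℤ + 0ℤ + z * 0ℤ
    ≡⟨ zeros z ⟩
  + 2 * z * 0ℤ ∎
  where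
  cols = vectors (allFin 2) n
  zeros : ∀ z → 0ℤ + 0ℤ + z * 0ℤ ≡ + 2 * z * 0ℤ
  zeros = solve-∀
∑-newColumn {n} z true b = begin
  c + ∑ cols (λ col → weightIf z (admissible true b col) (true ∷ refine true b col)) + z * w
    ≡⟨ cong (λ k → c + k + z * w)
         (trans (∑-cong cols (λ col → weightIf-true z (admissible true b col) (refine true b col)))
           (trans (∑-* cols z (columnWeight z true b)) (cong (z *_) (∑-columnWeight-true z b)))) ⟩
  c + z * w₁ + z * w
    ≡⟨ collect c (z * w₁) (z * w) ⟩
  c + z * w + z * w₁
    ≡⟨ cong (_+ z * w₁) (∑-columnWeight-false z b) ⟩
  z * w₁ + z * w₁
    ≡⟨ double z w₁ ⟩
  + 2 * z * w₁ ∎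
  where
  cols = vectors (allFin 2) n
  c  = ∑ cols (columnWeight z false b)
  w  = weight z b
  w₁ = weight (+ 1 + z) b
  collect : ∀ a b c → a + b + c ≡ a + c + b
  collect = solve-∀
  double : ∀ z a → z * a + z * a ≡ + 2 * z * a
  double = solve-∀

total : ∀ {n} → Vec Step n → ℤ → ℤ
total u z = ∑ (fillings (toList (rowsR u))) (λ F → weightIf z (does (tableau? u F)) (flags u F))

total-south : ∀ {n} (u : Vec Step n) z → total (south ∷ u) z ≡ z * total u z
total-south u z = begin
  total (south ∷ u) z
    ≡⟨ ∑-init (rowsR u) (λ F → weightIf z (does (tableau? u F)) (flags u F ∷ʳ true)) ⟩
  ∑ Fs (λ F → weightIf z (does (tableau? u F)) (flags u F ∷ʳ true))
    ≡⟨ ∑-cong Fs (λ F → go (does (tableau? u F)) (flags u F)) ⟩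
  ∑ Fs (λ F → z * weightIf z (does (tableau? u F)) (flags u F))
    ≡⟨ ∑-* Fs z _ ⟩
  z * total u z ∎
  where
  Fs = fillings (toList (rowsR u))
  go : ∀ {n} v (b : Vec Bool n) → weightIf z v (b ∷ʳ true) ≡ z * weightIf z v b
  go true  b = weight-∷ʳ-true z b
  go false b = sym (*-zeroʳ z)

total-west : ∀ {n} (u : Vec Step n) z →
             total (west ∷ u) z + z * total u z ≡ + 2 * z * total u (+ 1 + z)
total-west {n} u z = begin
  total (west ∷ u) z + z * total u z
    ≡⟨ cong (_+ z * total u z)
         (trans (∑-cartesianProductWith _∷_ (vectors (allFin 2) 1) Fs′ _)
           (cong₂ _+_ (fibre 0F) (trans (+-identityʳ _) (fibre 1F)))) ⟩
  ∑ Fs (λ F → ∑ cols (g 0F F)) + ∑ Fs (λ F → ∑ cols (g 1F F)) + z * total u z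
    ≡⟨ cong₂ _+_ (sym (∑-+ Fs _ _)) (sym (∑-* Fs z _)) ⟩
  ∑ Fs (λ F → ∑ cols (g 0F F) + ∑ cols (g 1F F)) +
  ∑ Fs (λ F → z * weightIf z (does (tableau? u F)) (flags u F))
    ≡⟨ sym (∑-+ Fs _ _) ⟩
  ∑ Fs (λ F → ∑ cols (g 0F F) + ∑ cols (g 1F F) + z * weightIf z (does (tableau? u F)) (flags u F))
    ≡⟨ ∑-cong Fs (λ F → ∑-newColumn z (does (tableau? u F)) (flags u F)) ⟩
  ∑ Fs (λ F → + 2 * z * weightIf (+ 1 + z) (does (tableau? u F)) (flags u F))
    ≡⟨ ∑-* Fs (+ 2 * z) _ ⟩
  + 2 * z * total u (+ 1 + z) ∎
  where
  Fs = fillings (toList (rowsR u))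
  Fs′ = fillings (toList (Vec.map suc (rowsR u)))
  cols = vectors (allFin 2) n

  g : Fin 2 → Filling (toList (rowsR u)) → Vec (Fin 2) n → ℤ
  g x F col = weightIf z (does (tableau? u F) ∧ admissible (isOne x) (flags u F) col)
                         (isOne x ∷ refine (isOne x) (flags u F) col)

  -- The old filling becomes the outer variable, so that the inner sum runs over the new columns for
  -- a fixed set of unrestricted rows.
  fibre : ∀ x → ∑ Fs′ (λ F → g x (tails (rowsR u) F) (heads (rowsR u) F)) ≡
                ∑ Fs (λ F → ∑ cols (g x F))
  fibre x = trans (∑-heads-tails (rowsR u) (λ col F → g x F col))
                  (∑-swap cols Fs (λ col F → g x F col))

-- From backward words to the tableaux themselves

columns-∷ʳ-south : ∀ {n} (w : Vec Step n) → columns (w ∷ʳ south) ≡ columns w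
columns-∷ʳ-south []          = refl
columns-∷ʳ-south (south ∷ w) = columns-∷ʳ-south w
columns-∷ʳ-south (west  ∷ w) = cong suc (columns-∷ʳ-south w)

columns-∷ʳ-west : ∀ {n} (w : Vec Step n) → columns (w ∷ʳ west) ≡ suc (columns w)
columns-∷ʳ-west []          = refl
columns-∷ʳ-west (south ∷ w) = columns-∷ʳ-west w
columns-∷ʳ-west (west  ∷ w) = cong suc (columns-∷ʳ-west w)

rowLengths-∷ʳ-south : ∀ {n} (w : Vec Step n) → rowLengths (w ∷ʳ south) ≡ rowLengths w ++ 0 ∷ []
rowLengths-∷ʳ-south []          = refl
rowLengths-∷ʳ-south (south ∷ w) = cong₂ _∷_ (columns-∷ʳ-south w) (rowLengths-∷ʳ-south w)
rowLengths-∷ʳ-south (west  ∷ w) = rowLengths-∷ʳ-south w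

rowLengths-∷ʳ-west : ∀ {n} (w : Vec Step n) → rowLengths (w ∷ʳ west) ≡ map suc (rowLengths w)
rowLengths-∷ʳ-west []          = refl
rowLengths-∷ʳ-west (south ∷ w) = cong₂ _∷_ (columns-∷ʳ-west w) (rowLengths-∷ʳ-west w)
rowLengths-∷ʳ-west (west  ∷ w) = rowLengths-∷ʳ-west w

columns-reverse : ∀ {n} (u : Vec Step n) → columns (reverse u) ≡ columns u
columns-reverse []          = refl
columns-reverse (south ∷ u) =
  trans (cong columns (reverse-∷ south u)) (trans (columns-∷ʳ-south (reverse u)) (columns-reverse u))
columns-reverse (west  ∷ u) =
  trans (cong columns (reverse-∷ west u))
        (trans (columns-∷ʳ-west (reverse u)) (cong suc (columns-reverse u)))

shiftedRowLengths-reverse : ∀ {n} (u : Vec Step n) → shiftedRowLengths (reverse u) ≡ toList (rowsR u)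
shiftedRowLengths-reverse []          = refl
shiftedRowLengths-reverse (south ∷ u) = begin
  shiftedRowLengths (reverse (south ∷ u))
    ≡⟨ cong shiftedRowLengths (reverse-∷ south u) ⟩
  shiftedRowLengths (reverse u ∷ʳ south)
    ≡⟨ cong₂ (λ c rows → applyUpTo {A = ℕ} suc c ++ rows)
         (columns-∷ʳ-south (reverse u)) (rowLengths-∷ʳ-south (reverse u)) ⟩
  applyUpTo suc (columns (reverse u)) ++ rowLengths (reverse u) ++ 0 ∷ []
    ≡⟨ sym (++-assoc (applyUpTo suc (columns (reverse u))) _ _) ⟩
  shiftedRowLengths (reverse u) ++ 0 ∷ []
    ≡⟨ cong (_++ 0 ∷ []) (shiftedRowLengths-reverse u) ⟩
  toList (rowsR u) ++ 0 ∷ []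
    ≡⟨ sym (toList-∷ʳ 0 (rowsR u)) ⟩
  toList (rowsR (south ∷ u)) ∎
shiftedRowLengths-reverse (west ∷ u) = begin
  shiftedRowLengths (reverse (west ∷ u))
    ≡⟨ cong shiftedRowLengths (reverse-∷ west u) ⟩
  shiftedRowLengths (reverse u ∷ʳ west)
    ≡⟨ cong₂ (λ c rows → applyUpTo {A = ℕ} suc c ++ rows)
         (columns-∷ʳ-west (reverse u)) (rowLengths-∷ʳ-west (reverse u)) ⟩
  1 ∷ applyUpTo (λ i → suc (suc i)) (columns (reverse u)) ++ map suc (rowLengths (reverse u))
    ≡⟨ cong (λ rows → 1 ∷ rows ++ map suc (rowLengths (reverse u)))
         (sym (map-applyUpTo {A = ℕ} {B = ℕ} suc suc (columns (reverse u)))) ⟩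
  1 ∷ map suc (applyUpTo suc (columns (reverse u))) ++ map suc (rowLengths (reverse u))
    ≡⟨ cong (1 ∷_) (sym (map-++ suc (applyUpTo suc (columns (reverse u))) _)) ⟩
  1 ∷ map suc (shiftedRowLengths (reverse u))
    ≡⟨ cong (λ rows → 1 ∷ map suc rows) (shiftedRowLengths-reverse u) ⟩
  1 ∷ map suc (toList (rowsR u))
    ≡⟨ cong (1 ∷_) (sym (toList-map suc (rowsR u))) ⟩
  toList (rowsR (west ∷ u)) ∎

-- At z = 1 every weight is 1, so `total u 1ℤ` is the number of tableaux with boundary `reverse u`.
does-isTableau? : ∀ {n} (u : Vec Step n) (a : ℤ) →
  ∑ (fillings (shiftedRowLengths (reverse u)))
    (λ F → if does (isTableau? (reverse u) F) then a else 0ℤ) ≡ a * total u 1ℤ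
does-isTableau? u a =
  go (columns-reverse u) (shiftedRowLengths-reverse u) (tableau? u) (flags u)
  where
  w = reverse u

  pull : ∀ {n} v (b : Vec Bool n) → (if v then a else 0ℤ) ≡ a * weightIf 1ℤ v b
  pull true  b = trans (sym (*-identityʳ a)) (cong (a *_) (sym (weight-1 b)))
  pull false b = sym (*-zeroʳ a)

  -- Column number and row list are made variables here so that both equations can be matched with
  -- `refl`, without transporting fillings.
  go : ∀ {c rows n} → columns w ≡ c → shiftedRowLengths w ≡ rows →
       (dec : (F : Filling rows) → Dec (Tableau c (cell F))) (b : Filling rows → Vec Bool n) →
       ∑ (fillings (shiftedRowLengths w)) (λ F → if does (isTableau? w F) then a else 0ℤ) ≡
       a * ∑ (fillings rows) (λ F → weightIf 1ℤ (does (dec F)) (b F))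
  go refl refl dec b = trans
    (∑-cong (fillings (shiftedRowLengths w)) λ F →
      trans (cong (if_then a else 0ℤ)
              (does-⇔ (mk⇔ (IsTableau⇒Tableau w F) (Tableau⇒IsTableau w F)) (isTableau? w F) (dec F)))
            (pull (does (dec F)) (b F)))
    (∑-* (fillings (shiftedRowLengths w)) a _)

∑-tableaux : ∀ n (f : Vec Step n → ℤ) →
  ∑ (tableaux n) (f ∘ proj₁) ≡ ∑ (vectors steps n) (λ u → f (reverse u) * total u 1ℤ)
∑-tableaux n f = begin
  ∑ (tableaux n) (f ∘ proj₁)
    ≡⟨ ∑-filter isTypeB? (filledDiagrams n) (f ∘ proj₁) ⟩
  ∑ (filledDiagrams n) (λ t → if does (isTypeB? t) then f (proj₁ t) else 0ℤ)
    ≡⟨ ∑-concatMap (λ w → map (w ,_) (fillings (shiftedRowLengths w))) (vectors steps n) _ ⟩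
  ∑ (vectors steps n) (λ w → ∑ (map (w ,_) (fillings (shiftedRowLengths w)))
    (λ t → if does (isTypeB? t) then f (proj₁ t) else 0ℤ))
    ≡⟨ ∑-cong (vectors steps n) (λ w → ∑-map {A = FilledDiagram n} (w ,_) (fillings (shiftedRowLengths w))
         (λ t → if does (isTypeB? t) then f (proj₁ t) else 0ℤ)) ⟩
  ∑ (vectors steps n) (λ w → ∑ (fillings (shiftedRowLengths w))
    (λ F → if does (isTableau? w F) then f w else 0ℤ))
    ≡⟨ ∑-vectors-reverse steps n _ ⟩
  ∑ (vectors steps n) (λ u → ∑ (fillings (shiftedRowLengths (reverse u)))
    (λ F → if does (isTableau? (reverse u) F) then f (reverse u) else 0ℤ))
    ≡⟨ ∑-cong (vectors steps n) (λ u → does-isTableau? u (f (reverse u))) ⟩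
  ∑ (vectors steps n) (λ u → f (reverse u) * total u 1ℤ) ∎

-- Consecutive west steps in a word

starts : ∀ {n} → Vec Step n → ℕ
starts []          = 0
starts (south ∷ _) = 0
starts (west  ∷ _) = 1

ww : ∀ {n} → Vec Step n → ℕ
ww []          = 0
ww (south ∷ u) = ww u
ww (west  ∷ u) = starts u ℕ.+ ww u

length-filter-tabulate : ∀ {A B : Set} {P : Pred A 0ℓ} {Q : Pred B 0ℓ}
  (P? : Decidable P) (Q? : Decidable Q) {n} (f : Fin n → A) (g : Fin n → B) →
  (∀ i → does (P? (f i)) ≡ does (Q? (g i))) →
  length (filter P? (tabulate f)) ≡ length (filter Q? (tabulate g))
length-filter-tabulate P? Q? {zero}  f g e = refl
length-filter-tabulate P? Q? {suc n} f g e with does (P? (f zero)) | does (Q? (g zero)) | e zero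
... | true  | true  | refl = cong suc (length-filter-tabulate P? Q? (f ∘ suc) (g ∘ suc) (e ∘ suc))
... | false | false | refl = length-filter-tabulate P? Q? (f ∘ suc) (g ∘ suc) (e ∘ suc)

-- Position 0 has no preceding step, so only the positions from 1 on are listed. Each later position
-- is then compared with its shift in the tail.
westWest-tail : ∀ {n} s (w : Vec Step n) →
                length (filter (westWest? (s ∷ w)) (tabulate suc)) ≡ ww (s ∷ w)
westWest-tail south [] = refl
westWest-tail west  [] = refl
westWest-tail s (t ∷ w) = cons s t
  where
  rest : ∀ s t → length (filter (westWest? (s ∷ t ∷ w)) (tabulate (λ i → suc (suc i)))) ≡ ww (t ∷ w)
  rest s t = trans
    (length-filter-tabulate (westWest? (s ∷ t ∷ w)) (westWest? (t ∷ w)) (λ i → suc (suc i)) suc λ i →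
      does-⇔ (mk⇔ (λ { (zero , () , _) ; (suc k , p , q) → k , ℕ.suc-injective p , q })
                  (λ { (k , p , q) → suc k , cong suc p , q }))
             (westWest? (s ∷ t ∷ w) (suc (suc i))) (westWest? (t ∷ w) (suc i)))
    (westWest-tail t w)

  cons : ∀ s t → length (filter (westWest? (s ∷ t ∷ w)) (tabulate suc)) ≡ ww (s ∷ t ∷ w)
  cons south t rewrite dec-false (westWest? (south ∷ t ∷ w) (suc zero))
    (λ { (zero , _ , () , _) ; (suc _ , () , _) }) = rest south t
  cons west south rewrite dec-false (westWest? (west ∷ south ∷ w) (suc zero))
    (λ { (_ , _ , _ , ()) }) = rest west south
  cons west west rewrite dec-true (westWest? (west ∷ west ∷ w) (suc zero))
    (zero , refl , refl , refl) = cong suc (rest west west)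

westWestCount≡ww : ∀ {n} (t : FilledDiagram n) → westWestCount t ≡ ww (proj₁ t)
westWestCount≡ww ([]    , _) = refl
westWestCount≡ww (s ∷ w , _) rewrite dec-false (westWest? (s ∷ w) zero) (λ { (_ , () , _) }) =
  westWest-tail s w

ww-∷ʳ : ∀ {n} (v : Vec Step n) t s → ww (v ∷ʳ t ∷ʳ s) ≡ ww (t ∷ s ∷ []) ℕ.+ ww (v ∷ʳ t)
ww-∷ʳ [] south south = refl
ww-∷ʳ [] south west  = refl
ww-∷ʳ [] west  south = refl
ww-∷ʳ [] west  west  = refl
ww-∷ʳ (south ∷ v) t s = ww-∷ʳ v t s
ww-∷ʳ (west  ∷ v) t s = begin
  starts (v ∷ʳ t ∷ʳ s) ℕ.+ ww (v ∷ʳ t ∷ʳ s)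
    ≡⟨ cong₂ ℕ._+_ (starts-∷ʳ v t) (ww-∷ʳ v t s) ⟩
  starts (v ∷ʳ t) ℕ.+ (ww (t ∷ s ∷ []) ℕ.+ ww (v ∷ʳ t))
    ≡⟨ exchange (starts (v ∷ʳ t)) (ww (t ∷ s ∷ [])) _ ⟩
  ww (t ∷ s ∷ []) ℕ.+ (starts (v ∷ʳ t) ℕ.+ ww (v ∷ʳ t)) ∎
  where
  starts-∷ʳ : ∀ {n} (v : Vec Step n) t → starts (v ∷ʳ t ∷ʳ s) ≡ starts (v ∷ʳ t)
  starts-∷ʳ []          south = refl
  starts-∷ʳ []          west  = refl
  starts-∷ʳ (south ∷ v) _     = refl
  starts-∷ʳ (west  ∷ v) _     = refl

  exchange : ∀ a b c → a ℕ.+ (b ℕ.+ c) ≡ b ℕ.+ (a ℕ.+ c)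
  exchange a b c = trans (sym (ℕ.+-assoc a b c))
                         (trans (cong (ℕ._+ c) (ℕ.+-comm a b)) (ℕ.+-assoc b a c))

-- Two adjacent west steps remain so when the word is read from the other end, so the statistic can
-- be computed on backward words.
ww-reverse : ∀ {n} (u : Vec Step n) → ww (reverse u) ≡ ww u
ww-reverse [] = refl
ww-reverse (south ∷ []) = refl
ww-reverse (west  ∷ []) = refl
ww-reverse (s ∷ t ∷ u) = begin
  ww (reverse (s ∷ t ∷ u))
    ≡⟨ cong ww (trans (reverse-∷ s (t ∷ u)) (cong (_∷ʳ s) (reverse-∷ t u))) ⟩
  ww (reverse u ∷ʳ t ∷ʳ s)
    ≡⟨ ww-∷ʳ (reverse u) t s ⟩
  ww (t ∷ s ∷ []) ℕ.+ ww (reverse u ∷ʳ t)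
    ≡⟨ cong (λ k → ww (t ∷ s ∷ []) ℕ.+ ww k) (sym (reverse-∷ t u)) ⟩
  ww (t ∷ s ∷ []) ℕ.+ ww (reverse (t ∷ u))
    ≡⟨ cong (λ k → ww (t ∷ s ∷ []) ℕ.+ k) (ww-reverse (t ∷ u)) ⟩
  ww (t ∷ s ∷ []) ℕ.+ ww (t ∷ u)
    ≡⟨ swap s t ⟩
  ww (s ∷ t ∷ u) ∎
  where
  swap : ∀ s t → ww (t ∷ s ∷ []) ℕ.+ ww (t ∷ u) ≡ ww (s ∷ t ∷ u)
  swap south south = refl
  swap south west  = refl
  swap west  south = refl
  swap west  west  = refl

-- Recurrences in z and the closed form

allTotal westTotal wwTotal : ℕ → ℤ → ℤ
allTotal n z = ∑ (vectors steps n) (λ u → total u z)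
westTotal n z = ∑ (vectors steps n) (λ u → + starts u * total u z)
wwTotal n z = ∑ (vectors steps n) (λ u → + ww u * total u z)

∑-steps : ∀ {n} (f : Vec Step (suc n) → ℤ) →
          ∑ (vectors steps (suc n)) f ≡ ∑ (vectors steps n) (λ u → f (south ∷ u) + f (west ∷ u))
∑-steps {n} f = trans (∑-cartesianProductWith _∷_ steps (vectors steps n) f)
  (trans (rearrange (∑ (vectors steps n) (f ∘ (south ∷_))) _)
         (sym (∑-+ (vectors steps n) _ _)))
  where
  rearrange : ∀ a b → a + (b + 0ℤ) ≡ a + b
  rearrange = solve-∀

total-west′ : ∀ {n} (u : Vec Step n) z →
               total (west ∷ u) z ≡ + 2 * z * total u (+ 1 + z) - z * total u z
total-west′ u z = trans (cancel (total (west ∷ u) z) (z * total u z))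
                         (cong (_- z * total u z) (total-west u z))
  where
  cancel : ∀ a b → a ≡ a + b - b
  cancel = solve-∀

allTotal-suc : ∀ n z → allTotal (suc n) z ≡ + 2 * z * allTotal n (+ 1 + z)
allTotal-suc n z = begin
  allTotal (suc n) z
    ≡⟨ ∑-steps {n} (λ u → total u z) ⟩
  ∑ (vectors steps n) (λ u → total (south ∷ u) z + total (west ∷ u) z)
    ≡⟨ ∑-cong (vectors steps n) (λ u → trans (cong₂ _+_ (total-south u z) (total-west′ u z))
         (cancel (z * total u z) _)) ⟩
  ∑ (vectors steps n) (λ u → + 2 * z * total u (+ 1 + z))
    ≡⟨ ∑-* (vectors steps n) (+ 2 * z) _ ⟩
  + 2 * z * allTotal n (+ 1 + z) ∎
  where
  cancel : ∀ a b → a + (b - a) ≡ b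
  cancel = solve-∀

westTotal-suc : ∀ n z → westTotal (suc n) z ≡ + 2 * z * allTotal n (+ 1 + z) + - z * allTotal n z
westTotal-suc n z = begin
  westTotal (suc n) z
    ≡⟨ ∑-steps {n} (λ u → + starts u * total u z) ⟩
  ∑ (vectors steps n) (λ u → + 0 * total (south ∷ u) z + + 1 * total (west ∷ u) z)
    ≡⟨ ∑-cong (vectors steps n) (λ u →
         trans (cong (λ k → + 0 * total (south ∷ u) z + + 1 * k) (total-west′ u z))
               (simplify z (total (south ∷ u) z) (total u (+ 1 + z)) (total u z))) ⟩
  ∑ (vectors steps n) (λ u → + 2 * z * total u (+ 1 + z) + - z * total u z)
    ≡⟨ ∑-+ (vectors steps n) _ _ ⟩
  ∑ (vectors steps n) (λ u → + 2 * z * total u (+ 1 + z)) + ∑ (vectors steps n) (λ u → - z * total u z)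
    ≡⟨ cong₂ _+_ (∑-* (vectors steps n) (+ 2 * z) _) (∑-* (vectors steps n) (- z) _) ⟩
  + 2 * z * allTotal n (+ 1 + z) + - z * allTotal n z ∎
  where
  simplify : ∀ z a b c → + 0 * a + + 1 * (+ 2 * z * b - z * c) ≡ + 2 * z * b + - z * c
  simplify = solve-∀

-- The pairs inside `u` are counted under both continuations, whose polynomials add up to 2 z times
-- that of `u` at 1 + z. The bracket collects the one new pair, created when a west step is put in
-- front of a word that starts with one.
wwTotal-suc : ∀ n z → wwTotal (suc n) z ≡
          + 2 * z * wwTotal n (+ 1 + z) + (+ 2 * z * westTotal n (+ 1 + z) + - z * westTotal n z)
wwTotal-suc n z = begin
  wwTotal (suc n) z
    ≡⟨ ∑-steps {n} (λ u → + ww u * total u z) ⟩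
  ∑ us (λ u → + ww u * total (south ∷ u) z + (+ starts u + + ww u) * total (west ∷ u) z)
    ≡⟨ ∑-cong us (λ u → trans
         (cong₂ (λ a b → + ww u * a + (+ starts u + + ww u) * b) (total-south u z) (total-west′ u z))
         (expand z (+ ww u) (+ starts u) (total u z) (total u (+ 1 + z)))) ⟩
  ∑ us (λ u → + 2 * z * (+ ww u * total u (+ 1 + z)) +
    (+ 2 * z * (+ starts u * total u (+ 1 + z)) + - z * (+ starts u * total u z)))
    ≡⟨ trans (∑-+ us _ _) (cong₂ _+_ (∑-* us (+ 2 * z) _)
         (trans (∑-+ us _ _) (cong₂ _+_ (∑-* us (+ 2 * z) _) (∑-* us (- z) _)))) ⟩
  + 2 * z * wwTotal n (+ 1 + z) + (+ 2 * z * westTotal n (+ 1 + z) + - z * westTotal n z) ∎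
  where
  us = vectors steps n
  expand : ∀ z w s t t₁ → w * (z * t) + (s + w) * (+ 2 * z * t₁ - z * t) ≡
           + 2 * z * (w * t₁) + (+ 2 * z * (s * t₁) + - z * (s * t))
  expand = solve-∀

-- This is how 2ⁿ z (z + 1) ... (z + n - 1) behaves under z ↦ z + 1: the factor z is exchanged for z
-- + n. Stated without division, it follows by induction from `allTotal-suc` alone.
allTotal-shift : ∀ n z → z * allTotal n (+ 1 + z) ≡ (z + + n) * allTotal n z
allTotal-shift zero    z = base z
  where
  base : ∀ z → z * + 1 ≡ (z + + 0) * + 1
  base = solve-∀
allTotal-shift (suc n) z = begin
  z * allTotal (suc n) (+ 1 + z)
    ≡⟨ cong (z *_) (allTotal-suc n (+ 1 + z)) ⟩
  z * (+ 2 * (+ 1 + z) * allTotal n (+ 1 + (+ 1 + z)))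
    ≡⟨ regroup z (allTotal n (+ 1 + (+ 1 + z))) ⟩
  + 2 * z * ((+ 1 + z) * allTotal n (+ 1 + (+ 1 + z)))
    ≡⟨ cong (λ k → + 2 * z * k) (allTotal-shift n (+ 1 + z)) ⟩
  + 2 * z * ((+ 1 + z + + n) * allTotal n (+ 1 + z))
    ≡⟨ commute z (+ n) (allTotal n (+ 1 + z)) ⟩
  (z + (+ 1 + + n)) * (+ 2 * z * allTotal n (+ 1 + z))
    ≡⟨ cong (λ k → (z + (+ 1 + + n)) * k) (sym (allTotal-suc n z)) ⟩
  (z + (+ 1 + + n)) * allTotal (suc n) z ∎
  where
  regroup : ∀ z t → z * (+ 2 * (+ 1 + z) * t) ≡ + 2 * z * ((+ 1 + z) * t)
  regroup = solve-∀
  commute : ∀ z n t → + 2 * z * ((+ 1 + z + n) * t) ≡ (z + (+ 1 + n)) * (+ 2 * z * t)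
  commute = solve-∀

-- The left side is the total over words of length n + 2 that start with two west steps. Expanding
-- both steps gives values at z, z + 1 and z + 2, and `allTotal-shift` brings all three back to z.
allTotal-west-west : ∀ n z → let y = z + + n in
  + 2 * z * westTotal (suc n) (+ 1 + z) + - z * westTotal (suc n) z ≡
  (+ 4 * y * (y + + 1) - (+ 4 * z + + 2) * y + z * z) * allTotal n z
allTotal-west-west n z = begin
  + 2 * z * westTotal (suc n) (+ 1 + z) + - z * westTotal (suc n) z
    ≡⟨ cong₂ (λ a b → + 2 * z * a + - z * b) (westTotal-suc n (+ 1 + z)) (westTotal-suc n z) ⟩
  + 2 * z * (+ 2 * (+ 1 + z) * t₂ + - (+ 1 + z) * t₁) + - z * (+ 2 * z * t₁ + - z * t₀)
    ≡⟨ regroup z t₀ t₁ t₂ ⟩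
  + 4 * z * ((+ 1 + z) * t₂) - (+ 4 * z + + 2) * (z * t₁) + z * z * t₀
    ≡⟨ cong (λ k → + 4 * z * k - (+ 4 * z + + 2) * (z * t₁) + z * z * t₀) (allTotal-shift n (+ 1 + z)) ⟩
  + 4 * z * ((+ 1 + z + + n) * t₁) - (+ 4 * z + + 2) * (z * t₁) + z * z * t₀
    ≡⟨ regroup₁ z (+ n) t₀ t₁ ⟩
  (+ 4 * (+ 1 + z + + n) - (+ 4 * z + + 2)) * (z * t₁) + z * z * t₀
    ≡⟨ cong (λ k → (+ 4 * (+ 1 + z + + n) - (+ 4 * z + + 2)) * k + z * z * t₀) (allTotal-shift n z) ⟩
  (+ 4 * (+ 1 + z + + n) - (+ 4 * z + + 2)) * ((z + + n) * t₀) + z * z * t₀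
    ≡⟨ regroup₂ z (+ n) t₀ ⟩
  (+ 4 * (z + + n) * (z + + n + + 1) - (+ 4 * z + + 2) * (z + + n) + z * z) * t₀ ∎
  where
  t₀ = allTotal n z
  t₁ = allTotal n (+ 1 + z)
  t₂ = allTotal n (+ 1 + (+ 1 + z))
  regroup : ∀ z t₀ t₁ t₂ →
    + 2 * z * (+ 2 * (+ 1 + z) * t₂ + - (+ 1 + z) * t₁) + - z * (+ 2 * z * t₁ + - z * t₀) ≡
    + 4 * z * ((+ 1 + z) * t₂) - (+ 4 * z + + 2) * (z * t₁) + z * z * t₀
  regroup = solve-∀
  regroup₁ : ∀ z n t₀ t₁ →
    + 4 * z * ((+ 1 + z + n) * t₁) - (+ 4 * z + + 2) * (z * t₁) + z * z * t₀ ≡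
    (+ 4 * (+ 1 + z + n) - (+ 4 * z + + 2)) * (z * t₁) + z * z * t₀
  regroup₁ = solve-∀
  regroup₂ : ∀ z n t₀ →
    (+ 4 * (+ 1 + z + n) - (+ 4 * z + + 2)) * ((z + n) * t₀) + z * z * t₀ ≡
    (+ 4 * (z + n) * (z + n + + 1) - (+ 4 * z + + 2) * (z + n) + z * z) * t₀
  regroup₂ = solve-∀

-- Six times the sum over x = z, …, z + n of 4 y (y + 1) - (4 x + 2) y + x²,
-- where y = z + n; the summand comes from allTotal-west-west.
wwPolynomial : ℤ → ℤ → ℤ
wwPolynomial n z = (n + + 1) * (+ 24 * (z + n) * (z + n + + 1) - + 24 * z * (z + n) - + 12 * (z + n)
                     - + 12 * n * (z + n) + + 6 * z * z + + 6 * z * n + n * (+ 2 * n + + 1))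

-- Unrolling `wwTotal-suc` replaces (n , z) by (n - 1 , z + 1), so z + n never changes, and the
-- factor 2 z is absorbed by `allTotal-suc`. Each stage thus adds one summand of the quadratic sum;
-- the factor 6 clears the denominators of the sum of squares.
wwTotal-closed : ∀ n z → + 6 * wwTotal (suc (suc n)) z ≡ wwPolynomial (+ n) z * allTotal n z
wwTotal-closed zero    z = begin
  + 6 * wwTotal 2 z
    ≡⟨ cong (λ k → + 6 * k) (trans (wwTotal-suc 1 z)
         (cong₂ (λ a b → + 2 * z * a + b) (wwTotal-1 (+ 1 + z)) (allTotal-west-west 0 z))) ⟩
  + 6 * (+ 2 * z * 0ℤ +
    (+ 4 * (z + + 0) * (z + + 0 + + 1) - (+ 4 * z + + 2) * (z + + 0) + z * z) * allTotal 0 z)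
    ≡⟨ base z ⟩
  wwPolynomial (+ 0) z * allTotal 0 z ∎
  where
  zeros : ∀ z → + 2 * z * 0ℤ + (+ 2 * z * 0ℤ + - z * 0ℤ) ≡ 0ℤ
  zeros = solve-∀
  -- A word of one step contains no pair, so the recursion starts from 0.
  wwTotal-1 : ∀ z → wwTotal 1 z ≡ 0ℤ
  wwTotal-1 z = trans (wwTotal-suc 0 z) (zeros z)
  base : ∀ z → + 6 * (+ 2 * z * 0ℤ +
    (+ 4 * (z + + 0) * (z + + 0 + + 1) - (+ 4 * z + + 2) * (z + + 0) + z * z) * + 1) ≡
    (+ 0 + + 1) * (+ 24 * (z + + 0) * (z + + 0 + + 1) - + 24 * z * (z + + 0) - + 12 * (z + + 0)
                     - + 12 * + 0 * (z + + 0) + + 6 * z * z + + 6 * z * + 0 + + 0 * (+ 2 * + 0 + + 1)) * + 1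
  base = solve-∀
wwTotal-closed (suc n) z = begin
  + 6 * wwTotal (suc (suc (suc n))) z
    ≡⟨ cong (λ k → + 6 * k) (trans (wwTotal-suc (suc (suc n)) z)
         (cong (λ k → + 2 * z * wwTotal (suc (suc n)) (+ 1 + z) + k) (allTotal-west-west (suc n) z))) ⟩
  + 6 * (+ 2 * z * wwTotal (suc (suc n)) (+ 1 + z) + q * allTotal (suc n) z)
    ≡⟨ distribute z (wwTotal (suc (suc n)) (+ 1 + z)) (q * allTotal (suc n) z) ⟩
  + 2 * z * (+ 6 * wwTotal (suc (suc n)) (+ 1 + z)) + + 6 * (q * allTotal (suc n) z)
    ≡⟨ cong₂ (λ a b → + 2 * z * a + + 6 * (q * b)) (wwTotal-closed n (+ 1 + z)) (allTotal-suc n z) ⟩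
  + 2 * z * (wwPolynomial (+ n) (+ 1 + z) * t) + + 6 * (q * (+ 2 * z * t))
    ≡⟨ collect z (wwPolynomial (+ n) (+ 1 + z)) q t ⟩
  (wwPolynomial (+ n) (+ 1 + z) + + 6 * q) * (+ 2 * z * t)
    ≡⟨ cong₂ _*_ (step (+ n) z) (sym (allTotal-suc n z)) ⟩
  wwPolynomial (+ 1 + + n) z * allTotal (suc n) z ∎
  where
  t = allTotal n (+ 1 + z)
  y = z + (+ 1 + + n)
  q = + 4 * y * (y + + 1) - (+ 4 * z + + 2) * y + z * z
  distribute : ∀ z m a → + 6 * (+ 2 * z * m + a) ≡ + 2 * z * (+ 6 * m) + + 6 * a
  distribute = solve-∀
  collect : ∀ z p q t → + 2 * z * (p * t) + + 6 * (q * (+ 2 * z * t)) ≡ (p + + 6 * q) * (+ 2 * z * t)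
  collect = solve-∀
  -- Prolonging the sum downwards by its term at x = z, with z + n + 1 as the common value of y.
  step : ∀ n z →
    (n + + 1) * (+ 24 * (+ 1 + z + n) * (+ 1 + z + n + + 1) - + 24 * (+ 1 + z) * (+ 1 + z + n)
      - + 12 * (+ 1 + z + n) - + 12 * n * (+ 1 + z + n) + + 6 * (+ 1 + z) * (+ 1 + z)
      + + 6 * (+ 1 + z) * n + n * (+ 2 * n + + 1))
    + + 6 * (+ 4 * (z + (+ 1 + n)) * (z + (+ 1 + n) + + 1)
      - (+ 4 * z + + 2) * (z + (+ 1 + n)) + z * z) ≡
    (+ 1 + n + + 1) * (+ 24 * (z + (+ 1 + n)) * (z + (+ 1 + n) + + 1) - + 24 * z * (z + (+ 1 + n))
      - + 12 * (z + (+ 1 + n)) - + 12 * (+ 1 + n) * (z + (+ 1 + n)) + + 6 * z * z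
      + + 6 * z * (+ 1 + n) + (+ 1 + n) * (+ 2 * (+ 1 + n) + + 1))
  step = solve-∀

allTotal-suc-1 : ∀ n → allTotal (suc n) 1ℤ ≡ + 2 * (+ 1 + + n) * allTotal n 1ℤ
allTotal-suc-1 n = begin
  allTotal (suc n) 1ℤ             ≡⟨ allTotal-suc n 1ℤ ⟩
  + 2 * 1ℤ * allTotal n (+ 2)     ≡⟨ regroup (allTotal n (+ 2)) ⟩
  + 2 * (1ℤ * allTotal n (+ 2))   ≡⟨ cong (λ k → + 2 * k) (allTotal-shift n 1ℤ) ⟩
  + 2 * ((+ 1 + + n) * allTotal n 1ℤ) ≡⟨ assoc (+ n) (allTotal n 1ℤ) ⟩
  + 2 * (+ 1 + + n) * allTotal n 1ℤ ∎
  where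
  regroup : ∀ t → + 2 * 1ℤ * t ≡ + 2 * (1ℤ * t)
  regroup = solve-∀
  assoc : ∀ n t → + 2 * ((+ 1 + n) * t) ≡ + 2 * (+ 1 + n) * t
  assoc = solve-∀

-- At z = 1 the polynomial factors as (n - 1) (14 n² - 25 n + 12), and two uses of `allTotal-suc-1`
-- give 4 n (n - 1) as the ratio of the totals for n and n - 2. The factor n - 1 cancels, leaving
-- the mean (14 n² - 25 n + 12) / (24 n).
wwTotal-allTotal : ∀ m → let n = + 2 + + m in
  + 24 * n * wwTotal (suc (suc m)) 1ℤ ≡
  (+ 14 * n * n - + 25 * n + + 12) * allTotal (suc (suc m)) 1ℤ
wwTotal-allTotal m = begin
  + 24 * (+ 2 + + m) * wwTotal (suc (suc m)) 1ℤ
    ≡⟨ regroup (+ m) (wwTotal (suc (suc m)) 1ℤ) ⟩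
  + 4 * (+ 2 + + m) * (+ 6 * wwTotal (suc (suc m)) 1ℤ)
    ≡⟨ cong (λ k → + 4 * (+ 2 + + m) * k) (wwTotal-closed m 1ℤ) ⟩
  + 4 * (+ 2 + + m) * (wwPolynomial (+ m) 1ℤ * allTotal m 1ℤ)
    ≡⟨ evaluate (+ m) (allTotal m 1ℤ) ⟩
  (+ 14 * (+ 2 + + m) * (+ 2 + + m) - + 25 * (+ 2 + + m) + + 12) *
    (+ 2 * (+ 1 + (+ 1 + + m)) * (+ 2 * (+ 1 + + m) * allTotal m 1ℤ))
    ≡⟨ cong (λ k → (+ 14 * (+ 2 + + m) * (+ 2 + + m) - + 25 * (+ 2 + + m) + + 12) * k)
         (sym (trans (allTotal-suc-1 (suc m)) (cong (λ k → + 2 * (+ 1 + (+ 1 + + m)) * k) (allTotal-suc-1 m)))) ⟩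
  (+ 14 * (+ 2 + + m) * (+ 2 + + m) - + 25 * (+ 2 + + m) + + 12) * allTotal (suc (suc m)) 1ℤ ∎
  where
  regroup : ∀ m a → + 24 * (+ 2 + m) * a ≡ + 4 * (+ 2 + m) * (+ 6 * a)
  regroup = solve-∀
  evaluate : ∀ m t → + 4 * (+ 2 + m) * ((m + + 1) * (+ 24 * (+ 1 + m) * (+ 1 + m + + 1)
      - + 24 * + 1 * (+ 1 + m) - + 12 * (+ 1 + m) - + 12 * m * (+ 1 + m)
      + + 6 * + 1 * + 1 + + 6 * + 1 * m + m * (+ 2 * m + + 1)) * t) ≡
    (+ 14 * (+ 2 + m) * (+ 2 + m) - + 25 * (+ 2 + m) + + 12) *
      (+ 2 * (+ 1 + (+ 1 + m)) * (+ 2 * (+ 1 + m) * t))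
  evaluate = solve-∀

-- The expected value

length-tableaux : ∀ n → + length (tableaux n) ≡ allTotal n 1ℤ
length-tableaux n = begin
  + length (tableaux n)                                ≡⟨ length-∑ (tableaux n) ⟩
  ∑ (tableaux n) (λ _ → 1ℤ)                            ≡⟨ ∑-tableaux n (λ _ → 1ℤ) ⟩
  ∑ (vectors steps n) (λ u → 1ℤ * total u 1ℤ)
    ≡⟨ ∑-cong (vectors steps n) (λ u → *-identityˡ (total u 1ℤ)) ⟩
  allTotal n 1ℤ ∎

sum-westWestCount : ∀ n → + sum (map westWestCount (tableaux n)) ≡ wwTotal n 1ℤ
sum-westWestCount n = begin
  + sum (map westWestCount (tableaux n))
    ≡⟨ sum-map westWestCount (tableaux n) ⟩
  ∑ (tableaux n) (λ t → + westWestCount t)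
    ≡⟨ ∑-cong (tableaux n) (λ t → cong +_ (westWestCount≡ww t)) ⟩
  ∑ (tableaux n) (λ t → + ww (proj₁ t))
    ≡⟨ ∑-tableaux n (λ w → + ww w) ⟩
  ∑ (vectors steps n) (λ u → + ww (reverse u) * total u 1ℤ)
    ≡⟨ ∑-cong (vectors steps n) (λ u → cong (λ k → + k * total u 1ℤ) (ww-reverse u)) ⟩
  wwTotal n 1ℤ ∎

-- On unnormalised fractions the equation is precisely the cross-multiplied hypothesis; the detour
-- avoids reasoning about reduction to lowest terms.
/-≡-/+/ : ∀ a b c p q r {{_ : NonZero p}} {{_ : NonZero q}} {{_ : NonZero r}} →
          a * (+ q * + r) ≡ (b * + r + c * + q) * + p → a / p ≡ b / q +ℚ c / r
/-≡-/+/ a b c (suc p) (suc q) (suc r) e = ℚ.toℚᵘ-injective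
  (ℚᵘ.≃-trans (ℚ.toℚᵘ-fromℚᵘ (mkℚᵘ a p))
    (ℚᵘ.≃-trans (*≡* e)
      (ℚᵘ.≃-sym (ℚᵘ.≃-trans (ℚ.toℚᵘ-homo-+ (b / suc q) (c / suc r))
        (ℚᵘ.+-cong (ℚ.toℚᵘ-fromℚᵘ (mkℚᵘ b q)) (ℚ.toℚᵘ-fromℚᵘ (mkℚᵘ c r)))))))

mainTheorem11 : (n : ℕ) (2≤n : 2 ≤ n) → 𝔼 n westWestCount ≡ (+ 14 * + n - + 25) / 24 +ℚ _/_ (+ 1) (2 ℕ.* n) {{2*n≢0 2≤n}}
mainTheorem11 n@(suc (suc m)) 2≤n@(s≤s (s≤s _)) =
  /-≡-/+/ S (+ 14 * + n - + 25) (+ 1) (length (tableaux n)) 24 (2 ℕ.* n)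
    {{tableaux≢0 n}} {{_}} {{2*n≢0 2≤n}} (begin
  S * (+ 24 * + (2 ℕ.* n))
    ≡⟨ cong (λ k → S * (+ 24 * k)) (pos-* 2 n) ⟩
  S * (+ 24 * (+ 2 * + n))
    ≡⟨ cong (_* (+ 24 * (+ 2 * + n))) (sum-westWestCount n) ⟩
  wwTotal n 1ℤ * (+ 24 * (+ 2 * + n))
    ≡⟨ regroup (wwTotal n 1ℤ) (+ n) ⟩
  + 2 * (+ 24 * + n * wwTotal n 1ℤ)
    ≡⟨ cong (λ k → + 2 * k) (wwTotal-allTotal m) ⟩
  + 2 * ((+ 14 * + n * + n - + 25 * + n + + 12) * allTotal n 1ℤ)
    ≡⟨ expand (+ n) (allTotal n 1ℤ) ⟩
  ((+ 14 * + n - + 25) * (+ 2 * + n) + + 1 * + 24) * allTotal n 1ℤ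
    ≡⟨ cong₂ (λ k l → ((+ 14 * + n - + 25) * k + + 1 * + 24) * l)
         (sym (pos-* 2 n)) (sym (length-tableaux n)) ⟩
  ((+ 14 * + n - + 25) * + (2 ℕ.* n) + + 1 * + 24) * + length (tableaux n) ∎)
  where
  S = + sum (map westWestCount (tableaux n))
  regroup : ∀ s n → s * (+ 24 * (+ 2 * n)) ≡ + 2 * (+ 24 * n * s)
  regroup = solve-∀
  expand : ∀ n t → + 2 * ((+ 14 * n * n - + 25 * n + + 12) * t) ≡
           ((+ 14 * n - + 25) * (+ 2 * n) + + 1 * + 24) * t
  expand = solve-∀
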